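{- Let $\alpha\in\mathbb{Z}/p\mathbb{Z}$; all entries and congruences below are in $\mathbb{Z}/p\mathbb{Z}$. (1) A $p$-regular partition $\lambda$ whose residue symbol has length $1$, $R_p(\lambda)=\left\{\begin{smallmatrix} x_1\\ y_1\end{smallmatrix}\right\}$, is a JS-partition of type $\alpha$ if and only if $(x_1,y_1)$ is one of $(0,\alpha)$ (only possible when $\alpha\neq 1$), $(\alpha,0)$, or $(\alpha,\alpha+1)$ (only possible when $\alpha\ne 0$). (2) Let $\mu$ be a $p$-regular partition with residue symbol $R_p(\mu)=\left\{\begin{smallmatrix} x_1&\cdots&x_k&x_{k+1}\\ y_1&\cdots&y_k&y_{k+1}\end{smallmatrix}\right\}$ of length $k+1\ge 2$, and let $\lambda$ be the partition with residue symbol $\left\{\begin{smallmatrix} x_1&\cdots&x_k\\ y_1&\cdots&y_k\end{smallmatrix}\right\}$ (i.e. $\mu$ with its $p$-rim removed). Then $\mu$ is a JS-partition of type $\alpha$ if and only if $\lambda$ is a JS-partition of type $\alpha$ and $(x_{k+1},y_{k+1})$ is one of the following: - $(\alpha+1-y_k,\ y_k-1)$, allowed only if $2y_k\not\equiv \alpha+3$ (regular extension); - $(y_k-1,\ \alpha+1-y_k)$, allowed only if $2y_k\not\equiv\alpha+1$ (regular extension); - $(y_k-1,\ y_k)$ (singular extension); - $(\alpha+1-y_k,\ \alpha+2-y_k)$ (singular extension). (3) If $\lambda$ is a JS-partition of type $\alpha$ with residue symbol of length $k$ and last column $\left\{\begin{smallmatrix} x_k\\ y_k\end{smallmatrix}\right\}$,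 and $\sigma=(\sigma_0,\dots,\sigma_{p-1})$ is its end value vector, then one of the following holds (with $e_i$ the vector of length $p$ having $1$ at position $i$ and $0$ elsewhere, and residues represented in $\{0,\dots,p-1\}$): (a) $\sigma=-e_0$ and $y_k\in\{1,\alpha+1\}$; (b) $\sigma=e_\alpha-e_\beta-e_{\alpha-\beta}$ for some residue $\beta\neq\alpha$, and $y_k\in\{1+\beta,\ \alpha+1-\beta\}$; (c) either $\alpha\neq 0$ is even, $\sigma=e_\alpha-2e_{\alpha/2}$ and $y_k=\frac{\alpha}{2}+1$; or $\alpha+p$ is even, $\sigma=e_\alpha-2e_{(p+\alpha)/2}$ and $y_k=\frac{\alpha+p}{2}+1$.
   Context: Fix an integer $p\ge 2$. A partition is written $\lambda=(l_1^{a_1},\dots,l_t^{a_t})$ with $l_1>\dots>l_t>0$ and $a_i\ge1$ (the first $a_1$ parts equal $l_1$, the next $a_2$ equal $l_2$, etc.); it is $p$-regular if $a_i\le p-1$ for all $i$. Its Young diagram is $Y(\lambda)=\{(i,j): 1\le i\le k, 1\le j\le\lambda_i\}$ where $\lambda_1\ge\dots\ge\lambda_k>0$ are the parts. A $p$-regular $\lambda$ is a JS-partition if $l_i-l_{i+1}+a_i+a_{i+1}\equiv 0\pmod p$ for $1\le i<t$; its type is the residue of $l_1-a_1$ mod $p$. Mullineux and residue symbols: the rim of $\lambda$ is the set of nodes $(i,j)\in Y(\lambda)$ with $(i+1,j+1)\notin Y(\lambda)$, ordered from the last node of the first row to the first node of the last row. The $p$-rim is the union of $p$-segments: the first $p$-segment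 consists of the first $p$ nodes of the rim (all of it if it has at most $p$ nodes); each next $p$-segment consists of the first $p$ nodes (or all remaining nodes) of the rim starting at the last node of the row immediately below the lowest row of the previous segment; this continues until the last row is reached. Let $a_1$ be the number of nodes of the $p$-rim of $\lambda^{(1)}=\lambda$ and $r_1$ its number of parts; removing the $p$-rim gives a $p$-regular partition $\lambda^{(2)}$; iterate to get $\lambda^{(1)},\dots,\lambda^{(m)}\ne\emptyset$, $\lambda^{(m+1)}=\emptyset$, with $a_j$ = size of the $p$-rim of $\lambda^{(j)}$ and $r_j$ = number of parts of $\lambda^{(j)}$. The Mullineux symbol is $G_p(\lambda)=\begin{pmatrix}a_1&\cdots&a_m\\ r_1&\cdots&r_m\end{pmatrix}$. The residue symbol is $R_p(\lambda)=\left\{\begin{smallmatrix}x_1&\cdots&x_m\\ y_1&\cdots&y_m\end{smallmatrix}\right\}$ with $x_j\equiv a_{m+1-j}-r_{m+1-j}$ and $y_j\equiv 1-r_{m+1-j}\pmod p$; $m$ is its length. Thus removing the last column of $R_p(\lambda)$ gives $R_p(\lambda^{(2)})$. A column is singular if $y_j=x_j+1$ (equivalently $p\mid a_{m+1-j}$) and regular otherwise. Mullineux sequence and end values: $M(\lambda)$ is the sequence of signed residues $0-,\ x_1+,\ (x_1+1)-,\ y_1+,\ (y_1-1)-,\ x_2+,\ (x_2+1)-,\ y_2+,\ (y_2-1)-,\ \dots,\ x_m+,\ (x_m+1)-,\ y_m+,\ (y_m-1)-$. For a residue $\beta$, the end value $\sigma_\beta$ is the sum, over all entries of $M(\lambda)$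 with residue $\beta$, of their signs ($+$ counts $+1$, $-$ counts $-1$). The end value vector is $\sigma=(\sigma_0,\dots,\sigma_{p-1})$. -}

module Defs where

open import Data.Nat as ℕ using (ℕ; zero; suc; _∸_; _⊓_; _≤_; _<_; _≡ᵇ_)
open import Data.Integer as ℤ using (ℤ; +_; _%ℕ_)
open import Data.Integer.Divisibility using (_∣_)
open import Data.List using (List; []; _∷_; map; reverse; concatMap; zipWith; filter; length; foldr)
open import Data.List.Relation.Unary.All using (All)
open import Data.List.Relation.Unary.Linked using (Linked)
open import Data.Product using (_×_; _,_)
open import Data.Bool using (if_then_else_)
open import Data.Empty using (⊥)
import Data.Nat.ListAction
open import Relation.Nullary.Decidable using (does)

-- Residues modulo p (elements of ℤ/pℤ are represented by integers,
-- equality in ℤ/pℤ is congruence mod p).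

Cong : ℕ → ℤ → ℤ → Set
Cong p a b = (+ p) ∣ (a ℤ.- b)

-- canonical representative in {0,…,p-1} (junk value for p = 0)
res : ℕ → ℤ → ℕ
res zero    z = 0
res (suc n) z = z %ℕ suc n

IsPartition : List ℕ → Set
IsPartition λs = Linked (λ a b → b ≤ a) λs × All (λ a → 0 < a) λs

-- the exponent form (l₁^a₁, …, l_t^a_t) as a list of pairs (lᵢ , aᵢ)
private
  push : ℕ → List (ℕ × ℕ) → List (ℕ × ℕ)
  push x []             = (x , 1) ∷ []
  push x ((l , a) ∷ gs) = if x ≡ᵇ l then (l , suc a) ∷ gs else (x , 1) ∷ (l , a) ∷ gs

groups : List ℕ → List (ℕ × ℕ)
groups = foldr push []

PRegular : ℕ → List ℕ → Set
PRegular p λs = All (λ g → Data.Product.proj₂ g ≤ p ∸ 1) (groups λs)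

JSRel : ℕ → ℕ × ℕ → ℕ × ℕ → Set
JSRel p (l , a) (l' , a') = Cong p ((+ l ℤ.- + l') ℤ.+ + a ℤ.+ + a') (+ 0)

HasType : ℕ → List (ℕ × ℕ) → ℤ → Set
HasType p []              α = ⊥
HasType p ((l , a) ∷ _)   α = Cong p (+ l ℤ.- + a) α

IsJS : ℕ → List ℕ → ℤ → Set
IsJS p λs α = PRegular p λs × Linked (JSRel p) (groups λs) × HasType p (groups λs) α

-- The p-rim.
-- Rim nodes of row i are the columns max(λᵢ₊₁,1),…,λᵢ (λ_{k+1} = 0),
-- traversed right to left, rows top to bottom; their number is
-- λᵢ ∸ (λᵢ₊₁ ∸ 1).  A p-segment is consumed with a budget b: in each row
-- it takes min(b, #rim nodes of the row) rightmost nodes; if the budget is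
-- exhausted in row i the next segment starts (budget p) at row i+1,
-- otherwise the current segment continues into row i+1.

private
  head0 : List ℕ → ℕ
  head0 []      = 0
  head0 (x ∷ _) = x

  nextBudget : ℕ → ℕ → ℕ
  nextBudget p zero    = p
  nextBudget p (suc b) = suc b

rimRemoved : ℕ → ℕ → List ℕ → List ℕ
rimRemoved p b []       = []
rimRemoved p b (l ∷ ls) =
  let c = l ∸ (head0 ls ∸ 1)
      t = b ℕ.⊓ c
  in t ∷ rimRemoved p (nextBudget p (b ∸ t)) ls

pRimSize : ℕ → List ℕ → ℕ
pRimSize p λs = Data.Nat.ListAction.sum (rimRemoved p p λs)

stripRim : ℕ → List ℕ → List ℕ
stripRim p λs = filter (λ x → 1 ℕ.≤? x) (zipWith _∸_ λs (rimRemoved p p λs))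

-- Mullineux symbol: list of columns (aⱼ , rⱼ), j = 1..m.
-- Iteration uses fuel |λ| (each step removes at least one node).

private
  mullFuel : ℕ → ℕ → List ℕ → List (ℕ × ℕ)
  mullFuel p zero    _        = []
  mullFuel p (suc n) []       = []
  mullFuel p (suc n) (l ∷ ls) =
    (pRimSize p (l ∷ ls) , length (l ∷ ls)) ∷ mullFuel p n (stripRim p (l ∷ ls))

mullineux : ℕ → List ℕ → List (ℕ × ℕ)
mullineux p λs = mullFuel p (Data.Nat.ListAction.sum λs) λs

-- Residue symbol: columns (xⱼ , yⱼ), j = 1..m, with
-- xⱼ = a_{m+1-j} - r_{m+1-j},  yⱼ = 1 - r_{m+1-j}  (as integers; only
-- their classes mod p matter).
residueSymbol : ℕ → List ℕ → List (ℤ × ℤ)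
residueSymbol p λs =
  reverse (map (λ ar → (+ Data.Product.proj₁ ar ℤ.- + Data.Product.proj₂ ar ,
                        + 1 ℤ.- + Data.Product.proj₂ ar))
               (mullineux p λs))

-- Mullineux sequence as (residue , sign) pairs, and end values.

mullSeq : List (ℤ × ℤ) → List (ℤ × ℤ)
mullSeq cols = (+ 0 , ℤ.-1ℤ) ∷ concatMap
  (λ xy → (Data.Product.proj₁ xy , ℤ.1ℤ) ∷ (Data.Product.proj₁ xy ℤ.+ + 1 , ℤ.-1ℤ)
        ∷ (Data.Product.proj₂ xy , ℤ.1ℤ) ∷ (Data.Product.proj₂ xy ℤ.- + 1 , ℤ.-1ℤ) ∷ [])
  cols

endValue : ℕ → List ℕ → ℕ → ℤ
endValue p λs β =
  foldr (λ rs acc → (if res p (Data.Product.proj₁ rs) ≡ᵇ β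
                      then Data.Product.proj₂ rs else + 0) ℤ.+ acc)
        (+ 0) (mullSeq (residueSymbol p λs))

e : ℕ → ℤ → ℕ → ℤ
e p γ i = if res p γ ≡ᵇ i then + 1 else + 0

{-# OPTIONS --safe #-}
module Submission where

-- Put a bead at position λᵢ + (number of rows below row i) for every row.  A
-- maximal run of beads is a group of equal parts, and λ is a JS-partition iff
-- every run is shorter than p and the bottom of each run is congruent to one
-- more than the top of the run above it.  Removing the p-rim moves the first
-- bead of each p-segment down by p positions; only the last segment may be
-- incomplete, and its first bead then drops to the lowest gap, position 0.
--
-- In a JS-partition the beads of one segment form either one run, or two runs
-- whose distance is forced by the congruence, so a local inspection shows that
-- the congruences between consecutive runs survive p-rim removal.  Conversely
-- they lift from λ to μ, except when a segment starts in the middle of a run of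
-- μ; such a fault propagates down to the last segment, where it contradicts the
-- admissible last columns.
--
-- The end value at i is Σ (δᵢ(z) − δᵢ(z + 1)) over the beads z, minus δᵢ at the
-- lowest gap, in coordinates shifted so that bead i is at λᵢ − i: p-rim removal
-- changes both by the contribution of one column.  For a JS-partition with k
-- rows the sum telescopes to δ(α) − δ(α + k) − δ(−k), which is (a) or (b) for
-- β = −k.

open import Defs
open import Data.Bool using (Bool; true; false; if_then_else_; T)
open import Data.Empty using (⊥; ⊥-elim)
open import Data.Integer as ℤ using (ℤ; +_)
import Data.Integer.DivMod as ℤ
import Data.Integer.Divisibility.Signed as ℤ∣
import Data.Integer.Properties as ℤ
import Data.Integer.Tactic.RingSolver as ℤSolver
open import Data.List using (List; []; _∷_; _++_; filter; foldr; length; map; replicate; reverse; zipWith)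
open import Data.List.Properties using (++-assoc; ++-conicalʳ; ++-identityʳ; ∷ʳ-injective; concatMap-++; filter-all; length-++; length-filter; length-replicate; unfold-reverse)
open import Data.List.Relation.Unary.All as All using (All; []; _∷_)
open import Data.List.Relation.Unary.All.Properties using (all-filter)
open import Data.List.Relation.Unary.Linked as Linked using (Linked; []; [-]; _∷_)
import Data.List.Relation.Unary.Linked.Properties as Linked
open import Data.Nat
open import Data.Nat.Divisibility using (_∣_; divides)
open import Data.Nat.DivMod
open import Data.Nat.ListAction using (sum)
open import Data.Nat.Properties
open import Data.Nat.Tactic.RingSolver using (solve-∀)
open import Data.Product using (Σ; _×_; _,_; proj₁; proj₂)
open import Data.Sum using (_⊎_; inj₁; inj₂)
open import Data.Unit using (⊤)
open import Function using (_∘_; flip)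
open import Function.Bundles using (_⇔_; mk⇔; Equivalence)
open import Function.Construct.Composition using (_⇔-∘_)
open import Relation.Nullary using (¬_; contradiction; Dec; yes; no)
open import Relation.Nullary.Decidable using (map′)
open import Relation.Binary.PropositionalEquality

open Equivalence

-- Partitions as words of beads and gaps.

Desc : List ℕ → Set
Desc = Linked (λ a b → b ≤ a)

Desc-weaken : ∀ {m n rs} → m ≤ n → Desc (m ∷ rs) → Desc (n ∷ rs)
Desc-weaken m≤n [-]       = [-]
Desc-weaken m≤n (r≤m ∷ d) = ≤-trans r≤m m≤n ∷ d

-- The bead word below height h, read from the top: true is a row, false a unit
-- drop in row length.  The position of a letter is the number of letters after
-- it.
wordFrom : ℕ → List ℕ → List Bool
wordFrom h []       = replicate h false
wordFrom h (r ∷ rs) = replicate (h ∸ r) false ++ true ∷ wordFrom r rs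

length-wordFrom : ∀ h rs → Desc (h ∷ rs) → length (wordFrom h rs) ≡ h + length rs
length-wordFrom h [] _ = trans (length-replicate h) (sym (+-identityʳ h))
length-wordFrom h (r ∷ rs) (r≤h ∷ d) = begin
  length (replicate (h ∸ r) false ++ true ∷ wordFrom r rs)      ≡⟨ length-++ (replicate (h ∸ r) false) ⟩
  length (replicate (h ∸ r) false) + suc (length (wordFrom r rs)) ≡⟨ cong₂ (λ a b → a + suc b) (length-replicate (h ∸ r)) (length-wordFrom r rs d) ⟩
  (h ∸ r) + suc (r + length rs)                                 ≡⟨ cong (λ k → (h ∸ r) + k) (sym (+-suc r (length rs))) ⟩
  (h ∸ r) + (r + suc (length rs))                               ≡⟨ +-assoc (h ∸ r) r _ ⟨
  (h ∸ r) + r + suc (length rs)                                 ≡⟨ cong (_+ suc (length rs)) (m∸n+n≡m r≤h) ⟩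
  h + suc (length rs) ∎
  where open ≡-Reasoning

replicate-+ : ∀ m n {w : List Bool} → replicate (m + n) false ++ w ≡ replicate m false ++ replicate n false ++ w
replicate-+ zero    n = refl
replicate-+ (suc m) n = cong (false ∷_) (replicate-+ m n)

wordFrom-gaps : ∀ m n rs → Desc (n ∷ rs) → wordFrom (m + n) rs ≡ replicate m false ++ wordFrom n rs
wordFrom-gaps zero    n []       d = refl
wordFrom-gaps (suc m) n []       d = cong (false ∷_) (wordFrom-gaps m n [] d)
wordFrom-gaps m n (r ∷ rs) (r≤n ∷ d) rewrite +-∸-assoc m r≤n = replicate-+ m (n ∸ r)

nonzero : List ℕ → List ℕ
nonzero = filter (1 ≤?_)

≡ᵇ-refl : ∀ x → (x ≡ᵇ x) ≡ true
≡ᵇ-refl zero    = refl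
≡ᵇ-refl (suc x) = ≡ᵇ-refl x

≡ᵇ-> : ∀ {x y} → y < x → (x ≡ᵇ y) ≡ false
≡ᵇ-> {suc x} {zero}  y<x       = refl
≡ᵇ-> {suc x} {suc y} (s≤s y<x) = ≡ᵇ-> y<x

groups-cons-≡ : ∀ {x a gs} xs → groups xs ≡ (x , a) ∷ gs → groups (x ∷ xs) ≡ (x , suc a) ∷ gs
groups-cons-≡ {x} xs eq rewrite eq | ≡ᵇ-refl x = refl

groups-cons-> : ∀ {x y a gs} xs → y < x → groups xs ≡ (y , a) ∷ gs → groups (x ∷ xs) ≡ (x , 1) ∷ (y , a) ∷ gs
groups-cons-> {x} {y} xs y<x eq rewrite eq | ≡ᵇ-> y<x = refl

groups-head : ∀ x xs → Σ ℕ λ a → Σ (List (ℕ × ℕ)) λ gs → groups (x ∷ xs) ≡ (x , a) ∷ gs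
groups-head x xs with groups xs
... | []           = 1 , [] , refl
... | (y , a) ∷ gs with x ≡ᵇ y in eq
...   | true  = suc a , gs , cong (λ z → (z , suc a) ∷ gs) (sym (≡ᵇ⇒≡ x y (subst T (sym eq) _)))
...   | false = 1 , (y , a) ∷ gs , refl

nonzero-zero : ∀ rs → Desc (0 ∷ rs) → nonzero rs ≡ []
nonzero-zero []       d         = refl
nonzero-zero (0 ∷ rs) (z≤n ∷ d) = nonzero-zero rs d

record FuelledMullineux (p : ℕ) : Set where
  field
    run       : ℕ → List ℕ → List (ℕ × ℕ)
    run-none  : ∀ xs → run 0 xs ≡ []
    run-[]    : ∀ n → run (suc n) [] ≡ []
    run-∷     : ∀ n l ls → run (suc n) (l ∷ ls) ≡ (pRimSize p (l ∷ ls) , length (l ∷ ls)) ∷ run n (stripRim p (l ∷ ls))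
    mullineux≡ : ∀ xs n → sum xs ≡ n → mullineux p xs ≡ run n xs

-- The recursion behind mullineux is private to Defs; it is recovered by
-- unification once its fuel argument is a variable.
fuelled : ∀ p → FuelledMullineux p
fuelled p = record
  { run = _
  ; run-none = λ xs → refl
  ; run-[] = λ n → refl
  ; run-∷ = λ n l ls → refl
  ; mullineux≡ = unfold
  }
  where
  unfold : ∀ xs n → sum xs ≡ n → mullineux p xs ≡ _
  unfold xs n eq with sum xs
  unfold xs n refl | _ = refl

sum-nonzero : ∀ xs → sum (nonzero xs) ≡ sum xs
sum-nonzero []           = refl
sum-nonzero (zero  ∷ xs) = sum-nonzero xs
sum-nonzero (suc x ∷ xs) = cong (λ k → suc x + k) (sum-nonzero xs)

-- The Boolean is the letter read just before the word, so that the empty word has a last letter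
-- too. Under this proviso, overwriting the last letter loses no bead.
Ends-in-gap : Bool → List Bool → Set
Ends-in-gap b     (y ∷ w) = Ends-in-gap y w
Ends-in-gap false []      = ⊤
Ends-in-gap true  []      = ⊥

ends-gaps : ∀ b n w → Ends-in-gap true w → Ends-in-gap b (replicate n false ++ w)
ends-gaps b n (y ∷ w) h = go b n
  where
  go : ∀ b n → Ends-in-gap b (replicate n false ++ y ∷ w)
  go b zero    = h
  go b (suc n) = go false n

ends-word : ∀ b l ls → All (0 <_) ls → Ends-in-gap b (wordFrom (suc l) ls)
ends-word b l [] _ = all-gaps l
  where
  all-gaps : ∀ n → Ends-in-gap false (replicate n false)
  all-gaps zero    = _
  all-gaps (suc n) = all-gaps n
ends-word b l (suc r ∷ ls) (_ ∷ pos) = ends-gaps b (suc l ∸ suc r) (true ∷ wordFrom (suc r) ls) (ends-word true r ls pos)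

module Modulo (q : ℕ) where

  p : ℕ
  p = suc (suc q)

  -- Residues modulo p

  infix 4 _≈_
  -- A record around the equation keeps `m` and `n` visible to unification, which cannot invert
  -- `_%_`.
  record _≈_ (m n : ℕ) : Set where
    constructor mod≡
    field %≡% : m % p ≡ n % p
  open _≈_

  ≈-refl : ∀ {m} → m ≈ m
  ≈-refl = mod≡ refl

  ≈-sym : ∀ {m n} → m ≈ n → n ≈ m
  ≈-sym (mod≡ eq) = mod≡ (sym eq)

  ≈-trans : ∀ {m n o} → m ≈ n → n ≈ o → m ≈ o
  ≈-trans (mod≡ eq) (mod≡ eq′) = mod≡ (trans eq eq′)

  ≈-reflexive : ∀ {m n} → m ≡ n → m ≈ n
  ≈-reflexive refl = ≈-refl

  -- Equal remainders leave only the quotients to compare: `n / p ≤ m / p` would give `n ≤ m`, and a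
  -- larger quotient would give `m + p ≤ n`.
  ≈-distinct : ∀ {m n} → m < n → n < m + p → ¬ m ≈ n
  ≈-distinct {m} {n} m<n n<m+p (mod≡ eq) with n / p ≤? m / p
  ... | yes le = <⇒≱ m<n (begin
          n                   ≡⟨ m≡m%n+[m/n]*n n p ⟩
          n % p + n / p * p   ≡⟨ cong (_+ n / p * p) (sym eq) ⟩
          m % p + n / p * p   ≤⟨ +-monoʳ-≤ (m % p) (*-monoˡ-≤ p le) ⟩
          m % p + m / p * p   ≡⟨ m≡m%n+[m/n]*n m p ⟨
          m                   ∎)
    where open ≤-Reasoning
  ... | no nle = <⇒≱ n<m+p (begin
          m + p                       ≡⟨ cong (_+ p) (m≡m%n+[m/n]*n m p) ⟩
          m % p + m / p * p + p       ≡⟨ +-assoc (m % p) _ p ⟩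
          m % p + (m / p * p + p)     ≡⟨ cong (λ k → m % p + k) (+-comm _ p) ⟩
          m % p + suc (m / p) * p     ≤⟨ +-monoʳ-≤ (m % p) (*-monoˡ-≤ p (≰⇒> nle)) ⟩
          m % p + n / p * p           ≡⟨ cong (_+ n / p * p) eq ⟩
          n % p + n / p * p           ≡⟨ m≡m%n+[m/n]*n n p ⟨
          n                           ∎)
    where open ≤-Reasoning

  +p≈ : ∀ m → m + p ≈ m
  +p≈ m = mod≡ ([m+n]%n≡m%n m p)

  suc-≈ : ∀ {m n} → m ≈ n → suc m ≈ suc n
  suc-≈ {m} {n} (mod≡ eq) = mod≡ (begin
    suc m % p              ≡⟨ %-distribˡ-+ 1 m p ⟩
    (1 % p + m % p) % p    ≡⟨ cong (λ z → (1 % p + z) % p) eq ⟩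
    (1 % p + n % p) % p    ≡⟨ %-distribˡ-+ 1 n p ⟨
    suc n % p              ∎)
    where open ≡-Reasoning

  -- Words and p-rim removal

  -- p-rim removal on words.  Between segments the transducer is idle; the next
  -- bead is the leader of a segment.  In state copy c, c letters are still to be
  -- copied before the position p below the leader, which receives a bead.  A word
  -- that ends earlier receives it at its last letter, assumed to be a gap.
  idle : List Bool → List Bool
  copy : ℕ → List Bool → List Bool
  idle []          = []
  idle (false ∷ w) = false ∷ idle w
  idle (true  ∷ w) = false ∷ copy (suc q) w
  copy c       []          = []
  copy zero    (false ∷ w) = true ∷ idle w
  copy zero    (true  ∷ w) = true ∷ copy (suc q) w
  copy (suc c) (y ∷ [])    = true ∷ []
  copy (suc c) (y ∷ z ∷ w) = y ∷ copy c (z ∷ w)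

  -- The position of the leader of the last segment if that segment is incomplete,
  -- and 0 otherwise.  Modulo p this is the size of the p-rim.
  lastLeader  : List Bool → ℕ
  lastLeaderᶜ : ℕ → List Bool → ℕ
  lastLeader []          = 0
  lastLeader (false ∷ w) = lastLeader w
  lastLeader (true  ∷ w) = lastLeaderᶜ (suc q) w
  lastLeaderᶜ c       []          = 0
  lastLeaderᶜ zero    (false ∷ w) = lastLeader w
  lastLeaderᶜ zero    (true  ∷ w) = lastLeaderᶜ (suc q) w
  lastLeaderᶜ (suc c) (y ∷ [])    = suc q ∸ c
  lastLeaderᶜ (suc c) (y ∷ z ∷ w) = lastLeaderᶜ c (z ∷ w)

  -- The JS condition on words: e is the residue required of the bottom of the next
  -- run, T the top of the current one.  F receives the residue that a further run
  -- would need and the number of trailing beads, which stand for empty rows and are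
  -- not subject to the condition.
  Chain : (ℕ → ℕ → Set) → ℕ → List Bool → Set
  Run   : (ℕ → ℕ → Set) → ℕ → ℕ → List Bool → Set
  Chain F e []          = F e 0
  Chain F e (false ∷ w) = Chain F e w
  Chain F e (true  ∷ w) = Run F e (length w) w
  Run F e T []          = F e (suc T)
  Run F e T (true  ∷ w) = Run F e T w
  Run F e T (false ∷ w) = (e ≈ suc (length w) × suc T < suc (length w) + p) × Chain F (suc T) w

  module _ {F F′ : ℕ → ℕ → Set} (F⇒F′ : ∀ {τ v} → F τ v → F′ τ v) where
    Chain-map : ∀ e w → Chain F e w → Chain F′ e w
    Run-map   : ∀ e T w → Run F e T w → Run F′ e T w
    Chain-map e []          g = F⇒F′ g
    Chain-map e (false ∷ w) g = Chain-map e w g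
    Chain-map e (true  ∷ w) g = Run-map e (length w) w g
    Run-map e T []          g = F⇒F′ g
    Run-map e T (true  ∷ w) g = Run-map e T w g
    Run-map e T (false ∷ w) (h , g) = h , Chain-map (suc T) w g

  closed : ℕ → ℕ → Set
  closed e v = v ≡ 0

  Regular : List Bool → Set
  RegularRun : ℕ → List Bool → Set
  Regular []          = ⊤
  Regular (false ∷ w) = Regular w
  Regular (true  ∷ w) = RegularRun (length w) w
  -- Trailing beads are rows of length 0, which a partition does not have.
  RegularRun T []          = ⊥
  RegularRun T (true  ∷ w) = RegularRun T w
  RegularRun T (false ∷ w) = suc T < suc (length w) + p × Regular w

  JSChain : ℕ → List Bool → Set
  JSChain = Chain closed

  JSRun : ℕ → ℕ → List Bool → Set
  JSRun = Run closed

  regular-bound : ∀ T w → RegularRun T w → suc T < length w + p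
  regular-bound T (true  ∷ w) r = m≤n⇒m≤1+n (regular-bound T w r)
  regular-bound T (false ∷ w) r = proj₁ r

  -- The admissible last columns, in terms of the p-rim size x, the residue τ required
  -- below the last run of λ, and the number v of rows lost.
  EndCond : ℕ → ℕ → ℕ → Set
  EndCond x τ v = (x ≈ 0 × (v ≈ 0 ⊎ τ ≈ 0))
                ⊎ (¬ x ≈ 0 × ((v ≈ 1 × x ≈ τ) ⊎ (τ ≈ 1 × x ≈ v)))

  JSChain-resp : ∀ {e e′} w → e ≈ e′ → JSChain e w → JSChain e′ w
  JSRun-resp : ∀ {e e′} T w → e ≈ e′ → JSRun e T w → JSRun e′ T w
  JSChain-resp []          eq g = g
  JSChain-resp (false ∷ w) eq g = JSChain-resp w eq g
  JSChain-resp (true  ∷ w) eq g = JSRun-resp (length w) w eq g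
  JSRun-resp T []          eq g = g
  JSRun-resp T (true  ∷ w) eq g = JSRun-resp T w eq g
  JSRun-resp T (false ∷ w) eq ((a , b) , g) = (≈-trans (≈-sym eq) a , b) , g

  length-idle : ∀ w → length (idle w) ≡ length w
  length-copy : ∀ c w → length (copy c w) ≡ length w
  length-idle []          = refl
  length-idle (false ∷ w) = cong suc (length-idle w)
  length-idle (true  ∷ w) = cong suc (length-copy (suc q) w)
  length-copy c       []          = refl
  length-copy zero    (false ∷ w) = cong suc (length-idle w)
  length-copy zero    (true  ∷ w) = cong suc (length-copy (suc q) w)
  length-copy (suc c) (y ∷ [])    = refl
  length-copy (suc c) (y ∷ z ∷ w) = cong suc (length-copy c (z ∷ w))

  -- An idle transducer answers every letter by a gap, so a run reaching it stops.
  idle-stops : ∀ F e T b w → Run F e T (idle (b ∷ w)) → e ≈ suc (length w) × Chain F (suc T) (idle (b ∷ w))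
  idle-stops F e T false w ((a , _) , g) = ≈-trans a (≈-reflexive (cong suc (length-idle w))) , g
  idle-stops F e T true  w ((a , _) , g) = ≈-trans a (≈-reflexive (cong suc (length-copy (suc q) w))) , g

  full-end : ∀ {τ v} → ¬ v ≈ 0 → EndCond 0 τ v → τ ≈ 0
  full-end v≉0 (inj₁ (_ , inj₁ v≈0)) = contradiction v≈0 v≉0
  full-end v≉0 (inj₁ (_ , inj₂ τ≈0)) = τ≈0
  full-end v≉0 (inj₂ (0≉0 , _))      = contradiction ≈-refl 0≉0

  -- Throughout, c + suc L ≡ length w + p says that the current leader is at L and
  -- that copying c letters of w leads to L − p.

  last≡leader : ∀ {c L} → c + suc L ≡ p → suc q ∸ c ≡ L
  last≡leader {c} {L} inv = trans (cong (_∸ c) (sym (suc-injective (trans (sym (+-suc c L)) inv)))) (m+n∸m≡n c L)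

  -- The last segment is incomplete here, so its leader satisfies 0 < `L` < p and is not divisible
  -- by p; only the second half of `EndCond` survives.
  partial-end : ∀ {c L τ v} → c + suc L ≡ p → 0 < L → EndCond (suc q ∸ c) τ v
              → (v ≈ 1 × L ≈ τ) ⊎ (τ ≈ 1 × L ≈ v)
  partial-end {c} {L} inv 0<L ec rewrite last≡leader {c} inv with ec
  ... | inj₁ (L≈0 , _) =
    contradiction (≈-sym L≈0) (≈-distinct 0<L (≤-trans (m≤n+m (suc L) c) (≤-reflexive inv)))
  ... | inj₂ (_ , h) = h

  copied : ∀ {e} c z w → e ≈ suc (length (copy c (z ∷ w))) → e ≈ suc (suc (length w))
  copied c z w a = ≈-trans a (≈-reflexive (cong suc (length-copy c (z ∷ w))))

  target≈ : ∀ {L n} → suc L ≡ suc n + p → L ≈ n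
  target≈ {L} {n} inv = ≈-trans (≈-reflexive (suc-injective inv)) (+p≈ n)

  start : ∀ n → suc q + suc n ≡ n + p
  start n = trans (+-suc (suc q) n) (+-comm p n)

  leader-bound : ∀ {c L} n → c + suc L ≡ n + p → L < n + p
  leader-bound {c} {L} n inv = ≤-trans (m≤n+m (suc L) c) (≤-reflexive inv)

  -- Chain conditions under p-rim removal

  -- Lifting from λ to μ, by recursion along the transducer. Between segments both words require the
  -- same residue `e` of the next run.
  idle-reflects : ∀ e w → Regular w → Chain (EndCond (lastLeader w)) e (idle w) → JSChain e w
  -- The leader `suc K` is the top of the run being copied. The image of that run starts at `K` and
  -- has the same bottom, so the next run of the image has to match the leader `suc K` itself.
  first-reflects : ∀ c e K w → c + suc (suc K) ≡ length w + p → length w ≤ suc K → RegularRun (suc K) w →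
    Run (EndCond (lastLeaderᶜ c w)) e K (copy c w) → JSRun e (suc K) w
  -- The leader's own run is over and no further bead has been met. If the leader was alone in its
  -- run, that run is missing from the image and `e` is still open; the next run of the image, whose
  -- bottom is at `L` - p, or else the final condition, then forces `e ≈ L`, just what the missing
  -- run needs.
  gap-reflects : ∀ c e L y w → c + suc L ≡ suc (length w) + p → suc (length w) < L → Regular (y ∷ w) →
    Chain (EndCond (lastLeaderᶜ c (y ∷ w))) e (copy c (y ∷ w)) → e ≈ L × JSChain (suc L) (y ∷ w)
  -- A second run has been entered within the segment. It has to stop right above the target `L` -
  -- p, so that the falling bead extends it downwards by one; stopping earlier is refuted by the
  -- bounds on `T` and `L`.
  run-reflects : ∀ c e L T y w → c + suc L ≡ suc (length w) + p → suc (length w) ≤ T → suc T < L → L < suc T + p →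
    RegularRun T (y ∷ w) → Run (EndCond (lastLeaderᶜ c (y ∷ w))) e T (copy c (y ∷ w)) → e ≈ L × JSRun (suc L) T (y ∷ w)
  -- Here the leader L lies inside a run of the original word with top T.
  no-inner-leader : ∀ c e L T w → c + suc L ≡ length w + p → length w ≤ L → L ≤ T → RegularRun T w →
    Run (EndCond (lastLeaderᶜ c w)) e T (copy c w) → ⊥

  idle-reflects e []          r g = refl
  idle-reflects e (false ∷ w) r g = idle-reflects e w r g
  idle-reflects e (true ∷ false ∷ []) (b , _) g with partial-end {q} {1} {e} {1} (+-comm q 2) (s≤s z≤n) g
  ... | inj₁ (_ , 1≈e) = (≈-sym 1≈e , b) , refl
  ... | inj₂ (e≈1 , _) = (e≈1 , b) , refl
  idle-reflects e (true ∷ true ∷ z ∷ w) r g =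
    first-reflects q e (length (z ∷ w)) (z ∷ w) (trans (+-suc q _) (start _)) (n≤1+n _) r
      (subst (λ n → Run (EndCond (lastLeaderᶜ q (z ∷ w))) e n (copy q (z ∷ w))) (length-copy q (z ∷ w)) g)
  idle-reflects e (true ∷ false ∷ z ∷ w) (b , r) g
    with gap-reflects q e _ z w (trans (+-suc q _) (start _)) ≤-refl r g
  ... | e≈L , h = (e≈L , b) , h

  -- The leader's run has fewer than p beads, so it is over before the position p below the leader.
  first-reflects zero    e K w inv _ r g = contradiction inv (<⇒≢ (regular-bound (suc K) w r))
  first-reflects (suc c) e K (false ∷ []) inv _ (b , _) g
    with partial-end {c} {suc K} {e} {suc K} (suc-injective inv) (s≤s z≤n) g
  ... | inj₁ (K≈1 , K≈e) = (≈-trans (≈-sym K≈e) K≈1 , b) , refl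
  ... | inj₂ (e≈1 , _)   = (e≈1 , b) , refl
  first-reflects (suc c) e K (true ∷ z ∷ w) inv le r g =
    first-reflects c e K (z ∷ w) (suc-injective inv) (<⇒≤ le) r g
  first-reflects (suc c) e K (false ∷ z ∷ w) inv le (b , r) ((a , _) , g) =
    (copied c z w a , b) , proj₂ (gap-reflects c (suc K) (suc K) z w (suc-injective inv) le r g)

  gap-reflects zero e L false [] inv _ r g = ≈-trans (full-end (≈-distinct z<s (s≤s (s≤s z≤n)) ∘ ≈-sym) g) (≈-sym (target≈ {L} inv)) , refl
  gap-reflects zero e L false (y ∷ w) inv _ r g =
    ≈-trans (proj₁ (idle-stops _ e _ y w g)) (≈-sym (target≈ {L} inv)) ,
    JSChain-resp (y ∷ w) (≈-trans (≈-reflexive (cong suc (length-idle (y ∷ w)))) (suc-≈ (≈-sym (target≈ {L} inv))))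
      (idle-reflects _ (y ∷ w) r (proj₂ (idle-stops _ e _ y w g)))
  -- The falling bead lands where the next leader has just left, so the run of that leader keeps its
  -- top in the image: the fault of `no-inner-leader`, with leader and `T` equal.
  gap-reflects zero e L true w inv _ r g rewrite length-copy (suc q) w =
    ⊥-elim (no-inner-leader (suc q) e (length w) (length w) w (start _) ≤-refl ≤-refl r g)
  gap-reflects (suc c) e L false [] inv 1<L r g
    with partial-end {c} {L} {e} {1} (suc-injective inv) (<⇒≤ 1<L) g
  ... | inj₁ (_ , L≈e)   = ≈-sym L≈e , refl
  ... | inj₂ (e≈1 , L≈1) = ≈-trans e≈1 (≈-sym L≈1) , refl
  gap-reflects (suc c) e L false (z ∷ w) inv lt r g =
    gap-reflects c e L z w (suc-injective inv) (<⇒≤ lt) r g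
  gap-reflects (suc c) e L true (z ∷ w) inv lt r g rewrite length-copy c (z ∷ w) =
    run-reflects c e L _ z w (suc-injective inv) ≤-refl lt
      (leader-bound {suc c} (suc (suc (length w))) inv) r g

  run-reflects zero e L T false [] inv _ T<L L<T+p (b , _) g =
    e≈L , (suc-≈ (target≈ {L} {0} inv) , b) , refl
    where
    L≡p : L ≡ p
    L≡p = suc-injective inv
    e≈L : e ≈ L
    e≈L = ≈-trans (full-end (≈-distinct z<s (subst (suc T <_) L≡p T<L) ∘ ≈-sym) g) (≈-sym (target≈ {L} {0} inv))
  run-reflects zero e L T false (y ∷ w) inv _ T<L L<T+p (b , r) g =
    ≈-trans (proj₁ (idle-stops _ e T y w g)) L≈ , (suc-≈ (≈-sym L≈) , b) ,
    idle-reflects _ (y ∷ w) r (proj₂ (idle-stops _ e T y w g))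
    where
    L≈ : suc (length w) ≈ L
    L≈ = ≈-sym (target≈ {L} inv)
  run-reflects zero e L T true w inv lt T<L L<T+p r g =
    ⊥-elim (no-inner-leader (suc q) e (length w) T w (start _) ≤-refl (<⇒≤ lt) r g)
  run-reflects (suc c) e L T false [] inv 1≤T T<L L<T+p r g
    with partial-end {c} {L} {e} {suc T} (suc-injective inv) (≤-trans (s≤s z≤n) T<L) g
  ... | inj₁ (T≈1 , _) =
    contradiction (≈-sym T≈1) (≈-distinct (s≤s 1≤T) (<-trans T<L (leader-bound {suc c} 1 inv)))
  ... | inj₂ (_ , L≈T) = contradiction (≈-sym L≈T) (≈-distinct T<L L<T+p)
  run-reflects (suc c) e L T true (z ∷ w) inv lt T<L L<T+p r g =
    run-reflects c e L T z w (suc-injective inv) (<⇒≤ lt) T<L L<T+p r g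
  -- A run ending here makes the image require `suc T` next, and `gap-reflects` turns this into
  -- `suc T ≈ L`.
  run-reflects (suc c) e L T false (z ∷ w) inv lt T<L L<T+p (b , r) ((a , _) , g) =
    contradiction (proj₁ (gap-reflects c (suc T) L z w (suc-injective inv) (≤-trans (≤-trans lt (n≤1+n T)) (<⇒≤ T<L)) r g)) (≈-distinct T<L L<T+p)

  no-inner-leader zero e L T w inv _ L≤T r g =
    <⇒≱ (regular-bound T w r) (≤-trans (≤-reflexive (sym inv)) (s≤s L≤T))
  no-inner-leader (suc c) e L T (false ∷ []) inv 1≤L L≤T (b , _) g
    with partial-end {c} {L} {e} {suc T} (suc-injective inv) 1≤L g
  ... | inj₁ (T≈1 , _) = ≈-distinct (s≤s (≤-trans 1≤L L≤T)) b (≈-sym T≈1)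
  ... | inj₂ (_ , L≈T) = ≈-distinct (s≤s L≤T) (≤-trans b (+-monoˡ-≤ p 1≤L)) L≈T
  no-inner-leader (suc c) e L T (true ∷ z ∷ w) inv le L≤T r g =
    no-inner-leader c e L T (z ∷ w) (suc-injective inv) (<⇒≤ le) L≤T r g
  -- The image run still has top `T` and asks for `suc T` below it, while `gap-reflects` needs `L`;
  -- the two differ by less than p.
  no-inner-leader (suc c) e L T (false ∷ z ∷ w) inv le L≤T (b , r) ((a , _) , g) =
    ≈-distinct (s≤s L≤T) (≤-trans b (+-monoˡ-≤ p le))
      (≈-sym (proj₁ (gap-reflects c (suc T) L z w (suc-injective inv) le r g)))

  -- Compared with EndCond, the bounds on v are those which rule out the columns
  -- excluded in (1).
  StrongEnd : ℕ → ℕ → ℕ → Set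
  StrongEnd x τ v = (x ≈ 0 × (v ≡ 0 ⊎ (τ ≈ 0 × 0 < v × v < p)))
                  ⊎ (¬ x ≈ 0 × ((v ≈ 1 × x ≈ τ) ⊎ (τ ≈ 1 × x ≈ v)))

  partial-end⁺ : ∀ {c L τ v} → c + suc L ≡ p → 0 < L
               → (v ≈ 1 × L ≈ τ) ⊎ (τ ≈ 1 × L ≈ v) → StrongEnd (suc q ∸ c) τ v
  partial-end⁺ {c} {L} inv 0<L h rewrite last≡leader {c} inv =
    inj₂ (≈-distinct 0<L (≤-trans (m≤n+m (suc L) c) (≤-reflexive inv)) ∘ ≈-sym , h)

  idle-stops⁺ : ∀ F {e T} b w → e ≈ suc (length w) → suc T < suc (length w) + p →
    Chain F (suc T) (idle (b ∷ w)) → Run F e T (idle (b ∷ w))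
  idle-stops⁺ F false w a b g rewrite length-idle w = (a , b) , g
  idle-stops⁺ F true  w a b g rewrite length-copy (suc q) w = (a , b) , g

  -- The bottom of the run is congruent to `e`. As `m` lies strictly above the bottom and at most
  -- one above the top, it exceeds the bottom by less than p.
  no-wrap : ∀ {e m} T w → JSRun e T w → length w < m → m ≤ suc T → ¬ e ≈ m
  no-wrap T (true  ∷ w) g lt le = no-wrap T w g (<⇒≤ lt) le
  no-wrap T (false ∷ w) ((a , b) , _) lt le e≈m =
    ≈-distinct lt (≤-<-trans le b) (≈-trans (≈-sym a) e≈m)

  JS-bound : ∀ {e} T w → JSRun e T w → suc T < length w + p
  JS-bound T (true  ∷ w) r = m≤n⇒m≤1+n (JS-bound T w r)
  JS-bound T (false ∷ w) ((_ , b) , _) = b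

  -- The converse runs through the same states, with `e ≈ L` now a hypothesis. There is no
  -- counterpart of `no-inner-leader`: in a JS word a falling bead always lands in a gap.
  idle-preserves : ∀ e w → JSChain e w → Chain (StrongEnd (lastLeader w)) e (idle w)
  first-preserves : ∀ c e K w → c + suc (suc K) ≡ length w + p → length w ≤ suc K → JSRun e (suc K) w →
    Run (StrongEnd (lastLeaderᶜ c w)) e K (copy c w)
  gap-preserves : ∀ c e L y w → c + suc L ≡ suc (length w) + p → suc (length w) < L → e ≈ L →
    JSChain (suc L) (y ∷ w) → Chain (StrongEnd (lastLeaderᶜ c (y ∷ w))) e (copy c (y ∷ w))
  run-preserves : ∀ c e L T y w → c + suc L ≡ suc (length w) + p → suc (length w) ≤ T → suc T < L → e ≈ L →
    JSRun (suc L) T (y ∷ w) → Run (StrongEnd (lastLeaderᶜ c (y ∷ w))) e T (copy c (y ∷ w))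

  idle-preserves e []          g = inj₁ (≈-refl , inj₁ refl)
  idle-preserves e (false ∷ w) g = idle-preserves e w g
  idle-preserves e (true ∷ false ∷ []) ((a , _) , _) =
    partial-end⁺ {q} {1} (+-comm q 2) (s≤s z≤n) (inj₂ (a , ≈-refl))
  idle-preserves e (true ∷ true ∷ z ∷ w) g =
    subst (λ n → Run (StrongEnd (lastLeaderᶜ q (z ∷ w))) e n (copy q (z ∷ w))) (sym (length-copy q (z ∷ w)))
      (first-preserves q e (length (z ∷ w)) (z ∷ w) (trans (+-suc q _) (start _)) (n≤1+n _) g)
  idle-preserves e (true ∷ false ∷ z ∷ w) ((a , _) , g) =
    gap-preserves q e _ z w (trans (+-suc q _) (start _)) ≤-refl a g

  first-preserves zero    e K w inv _ g = contradiction inv (<⇒≢ (JS-bound (suc K) w g))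
  first-preserves (suc c) e K (false ∷ []) inv _ ((a , _) , _) =
    partial-end⁺ {c} {suc K} (suc-injective inv) (s≤s z≤n) (inj₂ (a , ≈-refl))
  first-preserves (suc c) e K (true ∷ z ∷ w) inv le g =
    first-preserves c e K (z ∷ w) (suc-injective inv) (<⇒≤ le) g
  first-preserves (suc c) e K (false ∷ z ∷ w) inv le ((a , b) , g) =
    (≈-trans a (≈-reflexive (sym eq)) , subst (λ n → suc K < n + p) (sym eq) (<⇒≤ b)) ,
    gap-preserves c (suc K) (suc K) z w (suc-injective inv) le ≈-refl g
    where
    eq : suc (length (copy c (z ∷ w))) ≡ suc (suc (length w))
    eq = cong suc (length-copy c (z ∷ w))

  gap-preserves zero e L false [] inv _ e≈L _ =
    inj₁ (≈-refl , inj₂ (≈-trans e≈L (target≈ {L} {0} inv) , z<s , s≤s (s≤s z≤n)))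
  gap-preserves zero e L false (y ∷ w) inv _ e≈L g =
    idle-stops⁺ _ y w (≈-trans e≈L (target≈ {L} inv))
      (subst (λ n → suc n < suc (length w) + p) (sym (length-idle (y ∷ w)))
        (s≤s (≤-trans (≤-reflexive (+-comm 2 (length w))) (+-monoʳ-≤ (length w) (s≤s (s≤s z≤n))))))
      (idle-preserves _ (y ∷ w)
        (JSChain-resp (y ∷ w) (≈-trans (suc-≈ (target≈ {L} inv)) (≈-reflexive (cong suc (sym (length-idle (y ∷ w)))))) g))
  -- The run through the target `length w` would need a bottom congruent to `suc L`, hence to the
  -- position just above the target.
  gap-preserves zero e L true w inv _ e≈L g =
    contradiction (suc-≈ (target≈ {L} inv)) (no-wrap (length w) w g ≤-refl ≤-refl)
  gap-preserves (suc c) e L false [] inv 1<L e≈L _ =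
    partial-end⁺ {c} {L} (suc-injective inv) (<⇒≤ 1<L) (inj₁ (≈-refl , ≈-sym e≈L))
  gap-preserves (suc c) e L false (z ∷ w) inv lt e≈L g =
    gap-preserves c e L z w (suc-injective inv) (<⇒≤ lt) e≈L g
  gap-preserves (suc c) e L true (z ∷ w) inv lt e≈L g rewrite length-copy c (z ∷ w) =
    run-preserves c e L _ z w (suc-injective inv) ≤-refl lt e≈L g

  run-preserves zero e L T false [] inv _ T<L e≈L _ =
    inj₁ (≈-refl , inj₂ (≈-trans e≈L (target≈ {L} {0} inv) , z<s , subst (suc T <_) (suc-injective inv) T<L))
  run-preserves zero e L T false (y ∷ w) inv _ T<L e≈L ((_ , b) , g) =
    idle-stops⁺ _ y w (≈-trans e≈L (target≈ {L} inv)) (subst (suc T <_) (suc-injective inv) T<L) (idle-preserves _ (y ∷ w) g)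
  run-preserves zero e L T true w inv le T<L e≈L g =
    contradiction (suc-≈ (target≈ {L} inv)) (no-wrap T w g ≤-refl (m≤n⇒m≤1+n le))
  run-preserves (suc c) e L T false [] inv 1≤T T<L e≈L ((a , _) , _) =
    contradiction (≈-sym a) (≈-distinct (<-trans (s≤s 1≤T) (m≤n⇒m≤1+n T<L)) (s≤s (leader-bound {c} 0 (suc-injective inv))))
  run-preserves (suc c) e L T true (z ∷ w) inv le T<L e≈L g =
    run-preserves c e L T z w (suc-injective inv) (<⇒≤ le) T<L e≈L g
  run-preserves (suc c) e L T false (z ∷ w) inv le T<L e≈L ((a , _) , _) =
    contradiction (≈-sym a) (≈-distinct (s≤s (≤-trans le (<⇒≤ (<⇒≤ T<L)))) (s≤s (leader-bound {c} (suc (length w)) (suc-injective inv))))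

  -- Removing the p-rim row by row.

  stripped : ℕ → List ℕ → List ℕ
  stripped b rs = zipWith _∸_ rs (rimRemoved p b rs)

  -- Rim c m ls rem new: a segment with c + 1 nodes left enters the rows m + 1 ∷ ls,
  -- from which rem is removed, leaving new.
  data Rim : ℕ → ℕ → List ℕ → List ℕ → List ℕ → Set where
    end-full : ∀ c k → Rim c (c + k) [] (suc c ∷ []) (k ∷ [])
    end-part : ∀ m e → Rim (m + suc e) m [] (suc m ∷ []) (0 ∷ [])
    stop-in  : ∀ c k m ls {rem new} → Rim (suc q) m ls rem new →
               Rim c (c + (suc k + m)) (suc m ∷ ls) (suc c ∷ rem) (suc k + m ∷ new)
    stop-at  : ∀ c m ls {rem new} → Rim (suc q) m ls rem new →
               Rim c (c + m) (suc m ∷ ls) (suc c ∷ rem) (m ∷ new)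
    pass     : ∀ d e m ls {rem new} → Rim e m ls rem new →
               Rim (d + suc e) (d + m) (suc m ∷ ls) (suc d ∷ rem) (m ∷ new)

  -- If the next row is `suc m′`, the current one has `m ∸ m′` + 1 rim nodes; a last row has `m` +
  -- 1. Comparing this with the budget `c` + 1 decides whether the segment stops inside these nodes,
  -- stops exactly with them, or goes on.
  rim-view : ∀ c m ls → Desc (suc m ∷ ls) → All (0 <_) ls →
    Rim c m ls (rimRemoved p (suc c) (suc m ∷ ls)) (stripped (suc c) (suc m ∷ ls))
  rim-view c m [] d a with compare c m
  ... | less c k rewrite m≤n⇒m⊓n≡m (m≤n⇒m≤1+n (m≤m+n c k)) | sym (+-suc c k) | m+n∸m≡n c (suc k) = end-full c (suc k)
  ... | equal c rewrite ⊓-idem c | n∸n≡0 c = subst (λ m → Rim c m [] (suc c ∷ []) (0 ∷ [])) (+-identityʳ c) (end-full c 0)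
  ... | greater m k rewrite m≥n⇒m⊓n≡n (m≤n⇒m≤1+n (m≤m+n m k)) | n∸n≡0 m = subst (λ c → Rim c m [] (suc m ∷ []) (0 ∷ [])) (+-suc m k) (end-part m k)
  rim-view c m (suc m′ ∷ ls) (s≤s m′≤m ∷ d) (_ ∷ a) with m∸n+n≡m m′≤m
  ... | eq with m ∸ m′ in eq′
  rim-view c .(d + m′) (suc m′ ∷ ls) (s≤s m′≤m ∷ ds) (_ ∷ a) | refl | d
    rewrite +-∸-assoc 1 m′≤m | eq′ with compare c d
  ... | less c k rewrite m≤n⇒m⊓n≡m (m≤n⇒m≤1+n (m≤m+n c k)) | n∸n≡0 c | +-assoc c k m′ | sym (+-suc c (k + m′)) | m+n∸m≡n c (suc (k + m′))
      = stop-in c k m′ ls (rim-view (suc q) m′ ls ds a)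
  ... | equal c rewrite ⊓-idem c | n∸n≡0 c | m+n∸m≡n c m′ = stop-at c m′ ls (rim-view (suc q) m′ ls ds a)
  ... | greater d k rewrite m≥n⇒m⊓n≡n (m≤n⇒m≤1+n (m≤m+n d k)) | +-∸-assoc 1 (m≤m+n d k) | m+n∸m≡n d k | m+n∸m≡n d m′ | sym (+-suc d k)
      = pass d k m′ ls (rim-view k m′ ls ds a)

  -- Every row loses at least one node, so the new word may be read from height `m` instead of
  -- `suc m`.
  rim-desc : ∀ {c m ls rem new} → Rim c m ls rem new → Desc (m ∷ new)
  rim-desc (end-full c k) = m≤n+m k c ∷ [-]
  rim-desc (end-part m e) = z≤n ∷ [-]
  rim-desc (stop-in c k m ls r) = m≤n+m (suc k + m) c ∷ Desc-weaken (m≤n+m m (suc k)) (rim-desc r)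
  rim-desc (stop-at c m ls r) = m≤n+m m c ∷ rim-desc r
  rim-desc (pass d e m ls r) = m≤n+m m d ∷ rim-desc r

  copy-gaps : ∀ n c y w → copy (n + c) (replicate n false ++ y ∷ w) ≡ replicate n false ++ copy c (y ∷ w)
  copy-gaps zero          c y w = refl
  copy-gaps (suc zero)    c y w = refl
  copy-gaps (suc (suc n)) c y w = cong (false ∷_) (copy-gaps (suc n) c y w)

  idle-gaps : ∀ n w → idle (replicate n false ++ w) ≡ replicate n false ++ idle w
  idle-gaps zero    w = refl
  idle-gaps (suc n) w = cong (false ∷_) (idle-gaps n w)

  leader-copy-gaps : ∀ n c y w → lastLeaderᶜ (n + c) (replicate n false ++ y ∷ w) ≡ lastLeaderᶜ c (y ∷ w)
  leader-copy-gaps zero          c y w = refl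
  leader-copy-gaps (suc zero)    c y w = refl
  leader-copy-gaps (suc (suc n)) c y w = leader-copy-gaps (suc n) c y w

  leader-gaps : ∀ n w → lastLeader (replicate n false ++ w) ≡ lastLeader w
  leader-gaps zero    w = refl
  leader-gaps (suc n) w = leader-gaps n w

  gaps-word : ∀ n r rs → wordFrom (n + r) (r ∷ rs) ≡ replicate n false ++ true ∷ wordFrom r rs
  gaps-word n r rs rewrite m+n∸n≡m n r = refl

  gaps-word-suc : ∀ n m ls → wordFrom (suc (n + m)) (suc m ∷ ls) ≡ replicate n false ++ true ∷ wordFrom (suc m) ls
  gaps-word-suc n m ls rewrite m+n∸n≡m n m = refl

  -- The copying clause applies only if another letter follows. A word below a positive height is
  -- never empty, but this shows only after splitting on the next row.
  copy-bead : ∀ c m ls → copy (suc c) (true ∷ wordFrom (suc m) ls) ≡ true ∷ copy c (wordFrom (suc m) ls)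
  copy-bead c m []       = refl
  copy-bead c m (r ∷ ls) with suc m ∸ r
  ... | zero  = refl
  ... | suc _ = refl

  leader-copy-bead : ∀ c m ls → lastLeaderᶜ (suc c) (true ∷ wordFrom (suc m) ls) ≡ lastLeaderᶜ c (wordFrom (suc m) ls)
  leader-copy-bead c m []       = refl
  leader-copy-bead c m (r ∷ ls) with suc m ∸ r
  ... | zero  = refl
  ... | suc _ = refl

  gaps-end : ∀ c k → replicate (suc (c + k)) false ≡ replicate c false ++ false ∷ replicate k false
  gaps-end zero    k = refl
  gaps-end (suc c) k = cong (false ∷_) (gaps-end c k)

  gaps-snoc : ∀ k (w : List Bool) → replicate k false ++ false ∷ w ≡ false ∷ replicate k false ++ w
  gaps-snoc zero    w = refl
  gaps-snoc (suc k) w = cong (false ∷_) (gaps-snoc k w)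

  stop-in-word : ∀ c k m ls → wordFrom (suc (c + (suc k + m))) (suc m ∷ ls)
               ≡ replicate c false ++ false ∷ replicate k false ++ true ∷ wordFrom (suc m) ls
  stop-in-word c k m ls rewrite sym (+-assoc c (suc k) m) | m+n∸n≡m (c + suc k) m = replicate-+ c (suc k)

  -- A row that a segment passes through gets the length of the next row minus one. As one more row
  -- lies below it, its bead moves exactly onto the place of the next bead. Only the last row of a
  -- segment reaches a new place, p below the leader or at 0, so as a set of beads just the leader
  -- has moved.
  rim-word : ∀ {c m ls rem new} → Rim c m ls rem new → copy c (wordFrom (suc m) ls) ≡ wordFrom m new
  rim-word (end-full c k) = begin
    copy c (replicate (suc (c + k)) false)                          ≡⟨ cong (copy c) (gaps-end c k) ⟩
    copy c (replicate c false ++ false ∷ replicate k false)         ≡⟨ cong (λ n → copy n (replicate c false ++ false ∷ replicate k false)) (+-identityʳ c) ⟨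
    copy (c + 0) (replicate c false ++ false ∷ replicate k false)   ≡⟨ copy-gaps c 0 false (replicate k false) ⟩
    replicate c false ++ true ∷ idle (replicate k false)            ≡⟨ cong (λ w → replicate c false ++ true ∷ w) (idle-all k) ⟩
    replicate c false ++ true ∷ replicate k false                   ≡⟨ gaps-word c k [] ⟨
    wordFrom (c + k) (k ∷ [])                                       ∎
    where
    open ≡-Reasoning
    idle-all : ∀ k → idle (replicate k false) ≡ replicate k false
    idle-all zero    = refl
    idle-all (suc k) = cong (false ∷_) (idle-all k)
  rim-word (end-part m e) = begin
    copy (m + suc e) (replicate (suc m) false)              ≡⟨ cong (λ n → copy (m + suc e) (replicate (suc n) false)) (+-identityʳ m) ⟨
    copy (m + suc e) (replicate (suc (m + 0)) false)        ≡⟨ cong (copy (m + suc e)) (gaps-end m 0) ⟩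
    copy (m + suc e) (replicate m false ++ false ∷ [])      ≡⟨ copy-gaps m (suc e) false [] ⟩
    replicate m false ++ true ∷ []                          ∎
    where open ≡-Reasoning
  rim-word (stop-in c k m ls {new = new} r) = begin
    copy c (wordFrom (suc (c + (suc k + m))) (suc m ∷ ls))                ≡⟨ cong₂ copy (sym (+-identityʳ c)) (stop-in-word c k m ls) ⟩
    copy (c + 0) (replicate c false ++ false ∷ (replicate k false ++ true ∷ w)) ≡⟨ copy-gaps c 0 false _ ⟩
    replicate c false ++ true ∷ idle (replicate k false ++ true ∷ w)      ≡⟨ cong (λ v → replicate c false ++ true ∷ v) (idle-gaps k _) ⟩
    replicate c false ++ true ∷ replicate k false ++ false ∷ copy (suc q) w ≡⟨ cong (λ v → replicate c false ++ true ∷ replicate k false ++ false ∷ v) (rim-word r) ⟩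
    replicate c false ++ true ∷ replicate k false ++ false ∷ wordFrom m new ≡⟨ cong (λ v → replicate c false ++ true ∷ v) (gaps-snoc k _) ⟩
    replicate c false ++ true ∷ replicate (suc k) false ++ wordFrom m new ≡⟨ cong (λ v → replicate c false ++ true ∷ v) (wordFrom-gaps (suc k) m new (rim-desc r)) ⟨
    replicate c false ++ true ∷ wordFrom (suc k + m) new                  ≡⟨ gaps-word c (suc k + m) new ⟨
    wordFrom (c + (suc k + m)) (suc k + m ∷ new)                          ∎
    where
    open ≡-Reasoning
    w = wordFrom (suc m) ls
  rim-word (stop-at c m ls {new = new} r) = begin
    copy c (wordFrom (suc (c + m)) (suc m ∷ ls))            ≡⟨ cong₂ copy (sym (+-identityʳ c)) (gaps-word-suc c m ls) ⟩
    copy (c + 0) (replicate c false ++ true ∷ wordFrom (suc m) ls) ≡⟨ copy-gaps c 0 true _ ⟩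
    replicate c false ++ true ∷ copy (suc q) (wordFrom (suc m) ls) ≡⟨ cong (λ v → replicate c false ++ true ∷ v) (rim-word r) ⟩
    replicate c false ++ true ∷ wordFrom m new              ≡⟨ gaps-word c m new ⟨
    wordFrom (c + m) (m ∷ new)                              ∎
    where
    open ≡-Reasoning
  rim-word (pass d e m ls {new = new} r) = begin
    copy (d + suc e) (wordFrom (suc (d + m)) (suc m ∷ ls))  ≡⟨ cong (copy (d + suc e)) (gaps-word-suc d m ls) ⟩
    copy (d + suc e) (replicate d false ++ true ∷ w)        ≡⟨ copy-gaps d (suc e) true _ ⟩
    replicate d false ++ copy (suc e) (true ∷ w)            ≡⟨ cong (replicate d false ++_) (copy-bead e m ls) ⟩
    replicate d false ++ true ∷ copy e w                    ≡⟨ cong (λ v → replicate d false ++ true ∷ v) (rim-word r) ⟩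
    replicate d false ++ true ∷ wordFrom m new              ≡⟨ gaps-word d m new ⟨
    wordFrom (d + m) (m ∷ new)                              ∎
    where
    open ≡-Reasoning
    w = wordFrom (suc m) ls

  +-≈ : ∀ m {n o} → n ≈ o → m + n ≈ m + o
  +-≈ zero    eq = eq
  +-≈ (suc m) eq = suc-≈ (+-≈ m eq)

  -- A complete segment has p nodes. An incomplete one takes its leader down to position 0, one step
  -- per node, so its size is the position of the leader. The bound on `c` keeps the subtraction in
  -- `lastLeaderᶜ` exact.
  rim-size : ∀ {c m ls rem new} → Rim c m ls rem new → c ≤ suc q →
    sum rem ≈ suc c + lastLeaderᶜ c (wordFrom (suc m) ls)
  full-segment : ∀ c {m ls rem new x} → Rim (suc q) m ls rem new → x ≡ lastLeaderᶜ (suc q) (wordFrom (suc m) ls) →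
    suc c + sum rem ≈ suc c + x
  rim-size (end-full c k) _ = ≈-reflexive (cong (λ k → suc c + k) (sym (begin
    lastLeaderᶜ c (replicate (suc (c + k)) false)                        ≡⟨ cong₂ lastLeaderᶜ (sym (+-identityʳ c)) (gaps-end c k) ⟩
    lastLeaderᶜ (c + 0) (replicate c false ++ false ∷ replicate k false) ≡⟨ leader-copy-gaps c 0 false _ ⟩
    lastLeader (replicate k false)                                       ≡⟨ leader-none k ⟩
    0                                                                    ∎)))
    where
    open ≡-Reasoning
    leader-none : ∀ k → lastLeader (replicate k false) ≡ 0
    leader-none zero    = refl
    leader-none (suc k) = leader-none k
  rim-size (end-part m e) le = ≈-sym (≈-trans (≈-reflexive (begin
    suc (m + suc e) + lastLeaderᶜ (m + suc e) (replicate (suc m) false)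
      ≡⟨ cong (λ n → suc (m + suc e) + lastLeaderᶜ (m + suc e) (replicate (suc n) false)) (+-identityʳ m) ⟨
    suc (m + suc e) + lastLeaderᶜ (m + suc e) (replicate (suc (m + 0)) false)
      ≡⟨ cong (λ w → suc (m + suc e) + lastLeaderᶜ (m + suc e) w) (gaps-end m 0) ⟩
    suc (m + suc e) + lastLeaderᶜ (m + suc e) (replicate m false ++ false ∷ [])
      ≡⟨ cong (λ k → suc (m + suc e) + k) (leader-copy-gaps m (suc e) false []) ⟩
    suc (m + suc e) + (suc q ∸ e)        ≡⟨ cong (_+ (suc q ∸ e)) (cong suc (+-suc m e)) ⟩
    suc (suc (m + e)) + (suc q ∸ e)      ≡⟨ cong (λ n → suc (suc n)) (+-assoc m e _) ⟩
    suc (suc (m + (e + (suc q ∸ e))))    ≡⟨ cong (λ n → suc (suc (m + n))) (m+[n∸m]≡n e≤) ⟩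
    suc (suc (m + suc q))                ≡⟨ cong suc (sym (+-suc m (suc q))) ⟩
    suc m + p                            ≡⟨ cong (_+ p) (+-identityʳ (suc m)) ⟨
    suc m + 0 + p                        ∎)) (+p≈ _))
    where
    open ≡-Reasoning
    e≤ : e ≤ suc q
    e≤ = ≤-trans (n≤1+n e) (≤-trans (m≤n+m (suc e) m) le)
  rim-size (stop-in c k m ls r) _ = full-segment c r (begin
    lastLeaderᶜ c (wordFrom (suc (c + (suc k + m))) (suc m ∷ ls))  ≡⟨ cong₂ lastLeaderᶜ (sym (+-identityʳ c)) (stop-in-word c k m ls) ⟩
    lastLeaderᶜ (c + 0) (replicate c false ++ false ∷ _)           ≡⟨ leader-copy-gaps c 0 false _ ⟩
    lastLeader (replicate k false ++ true ∷ wordFrom (suc m) ls)   ≡⟨ leader-gaps k _ ⟩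
    lastLeaderᶜ (suc q) (wordFrom (suc m) ls)                      ∎)
    where open ≡-Reasoning
  rim-size (stop-at c m ls r) _ = full-segment c r (begin
    lastLeaderᶜ c (wordFrom (suc (c + m)) (suc m ∷ ls))   ≡⟨ cong₂ lastLeaderᶜ (sym (+-identityʳ c)) (gaps-word-suc c m ls) ⟩
    lastLeaderᶜ (c + 0) (replicate c false ++ true ∷ _)   ≡⟨ leader-copy-gaps c 0 true _ ⟩
    lastLeaderᶜ (suc q) (wordFrom (suc m) ls)             ∎)
    where open ≡-Reasoning
  rim-size (pass d e m ls {rem} r) le = ≈-trans (+-≈ (suc d) (rim-size r e≤)) (≈-reflexive (begin
    suc d + (suc e + lastLeaderᶜ e w)     ≡⟨ +-assoc (suc d) (suc e) _ ⟨
    suc d + suc e + lastLeaderᶜ e w       ≡⟨ cong (λ k → suc d + suc e + k) leader≡ ⟨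
    suc (d + suc e) + lastLeaderᶜ (d + suc e) (wordFrom (suc (d + m)) (suc m ∷ ls)) ∎))
    where
    open ≡-Reasoning
    w = wordFrom (suc m) ls
    e≤ : e ≤ suc q
    e≤ = ≤-trans (n≤1+n e) (≤-trans (m≤n+m (suc e) d) le)
    leader≡ : lastLeaderᶜ (d + suc e) (wordFrom (suc (d + m)) (suc m ∷ ls)) ≡ lastLeaderᶜ e w
    leader≡ = trans (cong (lastLeaderᶜ (d + suc e)) (gaps-word-suc d m ls))
                (trans (leader-copy-gaps d (suc e) true _) (leader-copy-bead e m ls))
  full-segment c {m} {ls} {rem} r refl = +-≈ (suc c) (≈-trans (rim-size r ≤-refl)
    (≈-trans (≈-reflexive (+-comm p _)) (+p≈ _)))

  rim-length : ∀ {c m ls rem new} → Rim c m ls rem new → length new ≡ suc (length ls)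
  rim-length (end-full c k)       = refl
  rim-length (end-part m e)       = refl
  rim-length (stop-in c k m ls r) = cong suc (rim-length r)
  rim-length (stop-at c m ls r)   = cong suc (rim-length r)
  rim-length (pass d e m ls r)    = cong suc (rim-length r)

  -- Congruences between integers

  infix 4 _≋_
  record _≋_ (a b : ℤ) : Set where
    constructor mk≋
    field toCong : Cong p a b
  open _≋_

  -- Congruences are derived by naming the coefficients of an integer linear combination of known
  -- ones; the identity that remains is a task for the ring solver.
  combine : ∀ s t {a b c d x y} → x ℤ.- y ≡ s ℤ.* (a ℤ.- b) ℤ.+ t ℤ.* (c ℤ.- d) → a ≋ b → c ≋ d → x ≋ y
  combine s t eq (mk≋ ab) (mk≋ cd) = mk≋ (ℤ∣.∣⇒∣ᵤ (subst (+ p ℤ∣.∣_) (sym eq)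
    (ℤ∣.∣m∣n⇒∣m+n (ℤ∣.∣n⇒∣m*n s (ℤ∣.∣ᵤ⇒∣ ab)) (ℤ∣.∣n⇒∣m*n t (ℤ∣.∣ᵤ⇒∣ cd)))))

  scale : ∀ s {a b x y} → x ℤ.- y ≡ s ℤ.* (a ℤ.- b) → a ≋ b → x ≋ y
  scale s eq (mk≋ ab) = mk≋ (ℤ∣.∣⇒∣ᵤ (subst (+ p ℤ∣.∣_) (sym eq) (ℤ∣.∣n⇒∣m*n s (ℤ∣.∣ᵤ⇒∣ ab))))

  combine₃ : ∀ s t u {a b c d e f x y} → x ℤ.- y ≡ s ℤ.* (a ℤ.- b) ℤ.+ t ℤ.* (c ℤ.- d) ℤ.+ u ℤ.* (e ℤ.- f) →
    a ≋ b → c ≋ d → e ≋ f → x ≋ y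
  combine₃ s t u eq (mk≋ ab) (mk≋ cd) (mk≋ ef) = mk≋ (ℤ∣.∣⇒∣ᵤ (subst (+ p ℤ∣.∣_) (sym eq)
    (ℤ∣.∣m∣n⇒∣m+n (ℤ∣.∣m∣n⇒∣m+n (ℤ∣.∣n⇒∣m*n s (ℤ∣.∣ᵤ⇒∣ ab)) (ℤ∣.∣n⇒∣m*n t (ℤ∣.∣ᵤ⇒∣ cd)))
      (ℤ∣.∣n⇒∣m*n u (ℤ∣.∣ᵤ⇒∣ ef)))))

  ∣+m-+n∣ : ∀ m n → ℤ.∣ + m ℤ.- + n ∣ ≡ ∣ m - n ∣
  ∣+m-+n∣ m n = trans (cong ℤ.∣_∣ (ℤ.m-n≡m⊖n m n)) (absolute m n (≤-total m n))
    where
    absolute : ∀ m n → m ≤ n ⊎ n ≤ m → ℤ.∣ m ℤ.⊖ n ∣ ≡ ∣ m - n ∣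
    absolute m n (inj₁ m≤n) = trans (ℤ.∣⊖∣-≤ m≤n) (sym (m≤n⇒∣m-n∣≡n∸m m≤n))
    absolute m n (inj₂ n≤m) = trans (cong ℤ.∣_∣ (ℤ.⊖-≥ n≤m)) (sym (m≤n⇒∣n-m∣≡n∸m n≤m))

  ≈⇒≋ : ∀ {m n} → m ≈ n → + m ≋ + n
  ≈⇒≋ {m} {n} (mod≡ eq) = mk≋ (subst (p ∣_) (sym (∣+m-+n∣ m n)) (divides ∣ m / p - n / p ∣ (begin
    ∣ m - n ∣                                                   ≡⟨ cong₂ ∣_-_∣ (m≡m%n+[m/n]*n m p) (m≡m%n+[m/n]*n n p) ⟩
    ∣ m % p + m / p * p - n % p + n / p * p ∣                   ≡⟨ cong (λ r → ∣ r + m / p * p - n % p + n / p * p ∣) eq ⟩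
    ∣ n % p + m / p * p - n % p + n / p * p ∣                   ≡⟨ ∣m+n-m+o∣≡∣n-o∣ (n % p) _ _ ⟩
    ∣ m / p * p - n / p * p ∣                                   ≡⟨ *-distribʳ-∣-∣ p (m / p) (n / p) ⟨
    ∣ m / p - n / p ∣ * p                                       ∎)))
    where open ≡-Reasoning

  ≋⇒≈ : ∀ {m n} → + m ≋ + n → m ≈ n
  ≋⇒≈ {m} {n} (mk≋ d) with subst (p ∣_) (∣+m-+n∣ m n) d | ≤-total m n
  ... | divides k eq | inj₁ m≤n = mod≡ (trans (sym ([m+kn]%n≡m%n m k p)) (cong (_% p)
          (trans (cong (λ k → m + k) (trans (sym eq) (m≤n⇒∣m-n∣≡n∸m m≤n))) (m+[n∸m]≡n m≤n))))
  ... | divides k eq | inj₂ n≤m = mod≡ (sym (trans (sym ([m+kn]%n≡m%n n k p)) (cong (_% p)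
          (trans (cong (λ k → n + k) (trans (sym eq) (m≤n⇒∣n-m∣≡n∸m n≤m))) (m+[n∸m]≡n n≤m)))))

  +-cancel-≈ : ∀ m {n o} → m + n ≈ m + o → n ≈ o
  +-cancel-≈ m {n} {o} eq = ≋⇒≈ (scale (+ 1) (lemma (+ m) (+ n) (+ o)) (≈⇒≋ eq))
    where
    lemma : ∀ a b c → b ℤ.- c ≡ + 1 ℤ.* ((a ℤ.+ b) ℤ.- (a ℤ.+ c))
    lemma = ℤSolver.solve-∀

  -- The JS condition on words and on exponents.

  module _ (F : ℕ → ℕ → Set) (F-resp : ∀ {τ τ′ v} → τ ≈ τ′ → F τ v → F τ′ v) where
    Run-zeros : ∀ e T rs → Desc (0 ∷ rs) → Run F e T (wordFrom 0 rs) ≡ F e (suc T)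
    Run-zeros e T []       d         = refl
    Run-zeros e T (0 ∷ rs) (z≤n ∷ d) = Run-zeros e T rs d

    Chain-gaps : ∀ e n w → Chain F e (replicate n false ++ w) ≡ Chain F e w
    Chain-gaps e zero    w = refl
    Chain-gaps e (suc n) w = Chain-gaps e n w

    Chain-zeros : ∀ e h rs → Desc (h ∷ rs) → nonzero rs ≡ [] → Chain F e (wordFrom h rs) ≡ F e (length rs)
    Chain-zeros e zero    []       _       _ = refl
    Chain-zeros e (suc h) []       _       _ = Chain-zeros e h [] [-] refl
    Chain-zeros e h       (0 ∷ rs) (_ ∷ d) _ = trans (Chain-gaps e h _) (trans (Run-zeros e _ rs d)
                                             (cong (λ n → F e (suc n)) (length-wordFrom 0 rs d)))

    -- A run of `a` beads carries the required residue from `e` to `suc T`, which is `e + a` by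
    -- `bottom`. Over `k` nonzero rows the requirement grows by `k` whatever their shape, and
    -- `final` is evaluated there.
    record RunJS (e T l a : ℕ) (gs : List (ℕ × ℕ)) (k v : ℕ) : Set where
      constructor runJS
      field
        linked  : Linked (JSRel p) ((l , a) ∷ gs)
        regular : All (λ g → proj₂ g ≤ suc q) ((l , a) ∷ gs)
        bottom  : suc T ≈ e + a
        final   : F (e + k) v

    close : ∀ {e T B} N → suc T ≡ N + B → (e ≈ B × suc T < B + p) ⇔ (N ≤ suc q × suc T ≈ e + N)
    close {e} {T} {B} N eq = mk⇔ forward backward
      where
      forward : e ≈ B × suc T < B + p → N ≤ suc q × suc T ≈ e + N
      forward (a , b) = s≤s⁻¹ (+-cancelʳ-< B N p (subst₂ _<_ eq (+-comm B p) b)) ,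
                   ≈-trans (≈-reflexive eq) (≈-trans (+-≈ N (≈-sym a)) (≈-reflexive (+-comm N e)))
      backward : N ≤ suc q × suc T ≈ e + N → e ≈ B × suc T < B + p
      backward (a , b) = +-cancel-≈ N (≈-trans (≈-reflexive (+-comm N e)) (≈-trans (≈-sym b) (≈-reflexive eq))) ,
                     subst₂ _<_ (sym eq) (+-comm p B) (+-monoˡ-< B (s≤s a))

    JSRel⇔ : ∀ l a l′ a′ → JSRel p (l , a) (l′ , a′) ⇔ l + a + a′ ≈ l′
    JSRel⇔ l a l′ a′ = mk⇔
      (λ r → ≋⇒≈ (scale (+ 1) (e₁ (+ l) (+ a) (+ l′) (+ a′)) (mk≋ {a = (+ l ℤ.- + l′) ℤ.+ + a ℤ.+ + a′} {+ 0} r)))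
      (λ r → toCong {a = (+ l ℤ.- + l′) ℤ.+ + a ℤ.+ + a′} {+ 0} (scale (+ 1) (e₂ (+ l) (+ a) (+ l′) (+ a′)) (≈⇒≋ r)))
      where
      e₁ : ∀ l a l′ a′ → l ℤ.+ a ℤ.+ a′ ℤ.- l′ ≡ + 1 ℤ.* ((l ℤ.- l′) ℤ.+ a ℤ.+ a′ ℤ.- + 0)
      e₁ = ℤSolver.solve-∀
      e₂ : ∀ l a l′ a′ → (l ℤ.- l′) ℤ.+ a ℤ.+ a′ ℤ.- + 0 ≡ + 1 ℤ.* (l ℤ.+ a ℤ.+ a′ ℤ.- l′)
      e₂ = ℤSolver.solve-∀

    -- n is the number of beads of the current run above the row suc l.
    run⇔ : ∀ e n T l ls {a gs} → Desc (suc l ∷ ls) → suc T ≡ n + suc (suc l + length ls) →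
      groups (nonzero (suc l ∷ ls)) ≡ (suc l , a) ∷ gs →
      Run F e T (wordFrom (suc l) ls) ⇔ RunJS e T (suc l) (n + a) gs (n + length (nonzero (suc l ∷ ls))) (length ls ∸ length (nonzero ls))
    run⇔ e n T l ls d posT eq = run e n T l ls d posT eq (next ls d)
      where
      data Next (l : ℕ) : List ℕ → Set where
        none  : ∀ {ls} → nonzero ls ≡ [] → Next l ls
        same  : ∀ {ls} → Next l (suc l ∷ ls)
        below : ∀ {l′ ls} → l′ < l → Next l (suc l′ ∷ ls)

      next : ∀ {l} ls → Desc (suc l ∷ ls) → Next l ls
      next []       _       = none refl
      next (zero ∷ ls) (_ ∷ d) = none (nonzero-zero ls d)
      next {l} (suc l′ ∷ ls) (s≤s l′≤l ∷ d) with m≤n⇒m<n∨m≡n l′≤l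
      ... | inj₁ l′<l = below l′<l
      ... | inj₂ refl = same

      lower : ∀ {l ls} → Desc (suc l ∷ ls) → nonzero ls ≡ [] → Desc (l ∷ ls)
      lower {ls = []}        d       nz = [-]
      lower {ls = zero ∷ ls} (_ ∷ d) nz = z≤n ∷ d

      run : ∀ e n T l ls {a gs} → Desc (suc l ∷ ls) → suc T ≡ n + suc (suc l + length ls) →
        groups (nonzero (suc l ∷ ls)) ≡ (suc l , a) ∷ gs → Next l ls →
        Run F e T (wordFrom (suc l) ls) ⇔ RunJS e T (suc l) (n + a) gs (n + length (nonzero (suc l ∷ ls))) (length ls ∸ length (nonzero ls))
      run e n T l ls d posT eq (none nz)
        rewrite nz | wordFrom-gaps 1 l ls (lower d nz)
        with eq
      ... | refl = mk⇔
        (λ { (h , g) → let (r , b) = to (close (n + 1) posT′) h in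
             runJS [-] (r ∷ []) b (F-resp b (subst (λ A → A) (Chain-zeros (suc T) l ls (lower d nz) nz) g)) })
        (λ { (runJS _ (r ∷ _) b f) →
             from (close (n + 1) posT′) (r , b) ,
             subst (λ A → A) (sym (Chain-zeros (suc T) l ls (lower d nz) nz)) (F-resp (≈-sym b) f) })
        where
        posT′ : suc T ≡ n + 1 + suc (length (wordFrom l ls))
        posT′ = trans posT (trans (cong (λ k → n + suc (suc k)) (sym (length-wordFrom l ls (lower d nz)))) (sym (+-assoc n 1 _)))
      run e n T l (suc l ∷ ls) (_ ∷ d) posT eq same with groups-head (suc l) (nonzero ls)
      ... | a′ , gs′ , eq′ with trans (sym eq) (groups-cons-≡ (suc l ∷ nonzero ls) eq′)
      ... | refl rewrite n∸n≡0 l =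
        subst₂ (λ N K → Run F e T (wordFrom (suc l) ls) ⇔ RunJS e T (suc l) N gs′ K (length ls ∸ length (nonzero ls)))
          (sym (+-suc n a′)) (sym (+-suc n (suc (length (nonzero ls)))))
          (run e (suc n) T l ls d (trans posT (trans (cong (λ k → n + suc (suc k)) (+-suc l (length ls))) (+-suc n _))) eq′ (next ls d))
      run e n T l (suc l′ ∷ ls) {a} {gs} (l′≤l ∷ d) posT eq (below l′<l) with groups-head (suc l′) (nonzero ls)
      ... | a′ , gs′ , eq′ with trans (sym eq) (groups-cons-> (suc l′ ∷ nonzero ls) (s≤s l′<l) eq′)
      ... | refl rewrite wordFrom-gaps 1 l (suc l′ ∷ ls) (l′<l ∷ d) | Chain-gaps (suc T) (l ∸ suc l′) (true ∷ wordFrom (suc l′) ls) =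
        mk⇔ forth back
        where
        w : List Bool
        w = wordFrom (suc l′) ls
        T′ = length w
        k = length (nonzero ls)
        v = length ls ∸ k
        ih : Run F (suc T) T′ w ⇔ RunJS (suc T) T′ (suc l′) a′ gs′ (suc k) v
        ih = run (suc T) 0 T′ l′ ls d (cong suc (length-wordFrom (suc l′) ls d)) eq′ (next ls d)
        B = suc (length (wordFrom l (suc l′ ∷ ls)))
        posB : B ≡ suc l + suc (length ls)
        posB = cong suc (length-wordFrom l (suc l′ ∷ ls) (l′<l ∷ d))
        posT′ : suc T ≡ n + 1 + B
        posT′ = trans posT (trans (cong (λ k → n + suc k) (sym posB)) (sym (+-assoc n 1 _)))
        final≈ : suc T ≈ e + (n + 1) → suc T + suc k ≈ e + (n + suc (suc k))
        final≈ b = ≈-trans (≈-reflexive (+-comm (suc T) (suc k))) (≈-trans (+-≈ (suc k) b) (≈-reflexive (arith (suc k) e n)))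
          where
          arith : ∀ k e n → k + (e + (n + 1)) ≡ e + (n + suc k)
          arith = solve-∀
        -- Adding the number `m` of rows below the upper group turns row lengths into bead
        -- positions.
        gap⇔ : suc l + (n + 1) + a′ ≈ suc l′ ⇔ suc T′ ≈ suc T + a′
        gap⇔ = mk⇔
          (λ eq → ≈-trans (≈-reflexive (sym lower≡)) (≈-trans (≈-sym (+-≈ m eq)) (≈-reflexive upper≡)))
          (λ eq → ≈-sym (+-cancel-≈ m (≈-trans (≈-reflexive lower≡) (≈-trans eq (≈-reflexive (sym upper≡))))))
          where
          m = suc (length ls)
          lower≡ : m + suc l′ ≡ suc T′
          lower≡ = trans (+-comm m (suc l′)) (trans (+-suc (suc l′) _) (cong suc (sym (length-wordFrom (suc l′) ls d))))
          arith : ∀ m l n a → m + (l + n + a) ≡ n + (l + m) + a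
          arith = solve-∀
          upper≡ : m + (suc l + (n + 1) + a′) ≡ suc T + a′
          upper≡ = trans (arith m (suc l) (n + 1) a′) (cong (_+ a′) (trans (cong (λ k → n + 1 + k) (sym posB)) (sym posT′)))
        forth : (e ≈ B × suc T < B + p) × Run F (suc T) T′ w → RunJS e T (suc l) (n + 1) ((suc l′ , a′) ∷ gs′) (n + suc (suc k)) v
        forth (h , r) with to (close (n + 1) posT′) h | to ih r
        ... | reg , b | runJS lk rg bt f = runJS (from (JSRel⇔ (suc l) (n + 1) (suc l′) a′) (from gap⇔ bt) ∷ lk) (reg ∷ rg) b (F-resp (final≈ b) f)
        back : RunJS e T (suc l) (n + 1) ((suc l′ , a′) ∷ gs′) (n + suc (suc k)) v → (e ≈ B × suc T < B + p) × Run F (suc T) T′ w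
        back (runJS (j ∷ lk) (reg ∷ rg) b f) =
          from (close (n + 1) posT′) (reg , b) , from ih (runJS lk rg (to gap⇔ (to (JSRel⇔ (suc l) (n + 1) (suc l′) a′) j)) (F-resp (≈-sym (final≈ b)) f))

    -- With k rows the bottom of the first run is at l₁ - a₁ + k, so the initial requirement α + k
    -- expresses the type. Empty rows count in k, because they raise every bead above them.
    js⇔ : ∀ α h l ls → Desc (suc l ∷ ls) →
      Chain F (α + suc (length ls)) (wordFrom h (suc l ∷ ls)) ⇔
      (IsJS p (nonzero (suc l ∷ ls)) (+ α) ×
       F (α + suc (length ls) + suc (length (nonzero ls))) (length ls ∸ length (nonzero ls)))
    js⇔ α h l ls d with groups-head (suc l) (nonzero ls)
    ... | a , gs , eq rewrite Chain-gaps (α + suc (length ls)) (h ∸ suc l) (true ∷ wordFrom (suc l) ls) | eq =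
      mk⇔ (λ r → let runJS lk rg bt f = to core r in (rg , lk , to type⇔ bt) , f)
          (λ { ((rg , lk , ty) , f) → from core (runJS lk rg (from type⇔ ty) f) })
      where
      e₀ = α + suc (length ls)
      T′ = length (wordFrom (suc l) ls)
      T≡ : T′ ≡ suc l + length ls
      T≡ = length-wordFrom (suc l) ls d
      core = run⇔ e₀ 0 T′ l ls d (cong suc T≡) eq
      type⇔ : suc T′ ≈ e₀ + a ⇔ Cong p (+ suc l ℤ.- + a) (+ α)
      type⇔ = mk⇔
        (λ b → toCong {a = + suc l ℤ.- + a} {+ α} (scale (+ 1) (e₁ (+ suc l) (+ a) (+ α) (+ suc (length ls)))
           (≈⇒≋ (≈-trans (≈-reflexive (trans (+-suc (suc l) (length ls)) (cong suc (sym T≡)))) b))))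
        (λ c → ≈-trans (≈-reflexive (trans (cong suc T≡) (sym (+-suc (suc l) (length ls)))))
           (≋⇒≈ (scale (+ 1) (e₂ (+ suc l) (+ a) (+ α) (+ suc (length ls))) (mk≋ {a = + suc l ℤ.- + a} {+ α} c))))
        where
        e₁ : ∀ l a α k → l ℤ.- a ℤ.- α ≡ + 1 ℤ.* (l ℤ.+ k ℤ.- (α ℤ.+ k ℤ.+ a))
        e₁ = ℤSolver.solve-∀
        e₂ : ∀ l a α k → l ℤ.+ k ℤ.- (α ℤ.+ k ℤ.+ a) ≡ + 1 ℤ.* (l ℤ.- a ℤ.- α)
        e₂ = ℤSolver.solve-∀

    js⇔′ : ∀ α h rs → Desc rs → nonzero rs ≢ [] →
      Chain F (α + length rs) (wordFrom h rs) ⇔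
      (IsJS p (nonzero rs) (+ α) × F (α + length rs + length (nonzero rs)) (length rs ∸ length (nonzero rs)))
    js⇔′ α h []           d ne = contradiction refl ne
    js⇔′ α h (zero ∷ rs)  d ne = contradiction (nonzero-zero rs d) ne
    js⇔′ α h (suc l ∷ ls) d ne = js⇔ α h l ls d

  regular-gaps : ∀ n {w} → Regular w → Regular (replicate n false ++ w)
  regular-gaps zero    r = r
  regular-gaps (suc n) r = regular-gaps n r

  regular-bottom : ∀ {N T B} → N ≤ suc q → suc T ≡ N + B → suc T < B + p
  regular-bottom {N} {T} {B} N≤ eq = subst₂ _<_ (sym eq) (+-comm p B) (+-monoˡ-< B (s≤s N≤))

  regular-run : ∀ n T l ls {a gs} → Desc (suc l ∷ ls) → All (0 <_) ls → suc T ≡ n + suc (suc l + length ls) →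
    groups (suc l ∷ ls) ≡ (suc l , a) ∷ gs → All (λ g → proj₂ g ≤ suc q) ((suc l , n + a) ∷ gs) →
    RegularRun T (wordFrom (suc l) ls)
  regular-run n T l [] d pos posT refl (r ∷ _) =
    regular-bottom r (trans posT (trans (sym (+-assoc n 1 _)) (cong (λ k → n + 1 + suc k)
      (trans (+-identityʳ l) (sym (length-replicate l)))))) ,
    subst Regular (++-identityʳ (replicate l false)) (regular-gaps l {[]} _)
  regular-run n T l (suc l′ ∷ ls) (s≤s l′≤l ∷ d) (_ ∷ pos) posT eq reg with groups-head (suc l′) ls | m≤n⇒m<n∨m≡n l′≤l
  ... | a′ , gs′ , eq′ | inj₂ refl with trans (sym eq) (groups-cons-≡ (suc l′ ∷ ls) eq′)
  ... | refl rewrite n∸n≡0 l = regular-run (suc n) T l ls d pos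
          (trans posT (trans (cong (λ k → n + suc (suc k)) (+-suc l (length ls))) (+-suc n _))) eq′
          (subst (λ k → All (λ g → proj₂ g ≤ suc q) ((suc l , k) ∷ gs′)) (+-suc n a′) reg)
  regular-run n T l (suc l′ ∷ ls) (s≤s l′≤l ∷ d) (_ ∷ pos) posT eq reg | a′ , gs′ , eq′ | inj₁ l′<l
    with trans (sym eq) (groups-cons-> (suc l′ ∷ ls) (s≤s l′<l) eq′) | reg
  ... | refl | r ∷ rs rewrite wordFrom-gaps 1 l (suc l′ ∷ ls) (l′<l ∷ d) =
    regular-bottom r (trans posT (trans (cong (λ k → n + suc k) (cong suc (sym (length-wordFrom l (suc l′ ∷ ls) (l′<l ∷ d)))))
      (sym (+-assoc n 1 _)))) ,
    regular-gaps (l ∸ suc l′) (regular-run 0 _ l′ ls d pos (cong suc (length-wordFrom (suc l′) ls d)) eq′ rs)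

  regular-word : ∀ h l ls → Desc (suc l ∷ ls) → All (0 <_) ls → PRegular p (suc l ∷ ls) → Regular (wordFrom h (suc l ∷ ls))
  regular-word h l ls d pos reg with groups-head (suc l) ls
  ... | a , gs , eq = regular-gaps (h ∸ suc l) (regular-run 0 _ l ls d pos (cong suc (length-wordFrom (suc l) ls d)) eq (subst (All _) eq reg))

  -- The residue symbol as a recursion along p-rim removal.

  rim-sum : ∀ {c m ls rem new} → Rim c m ls rem new → sum new < suc m + sum ls
  rim-sum (end-full c k) = s≤s (+-monoˡ-≤ 0 (m≤n+m k c))
  rim-sum (end-part m e) = z<s
  rim-sum (stop-in c k m ls r) = +-mono-≤-< (≤-trans (m≤n+m _ c) (n≤1+n _)) (rim-sum r)
  rim-sum (stop-at c m ls r) = +-mono-≤-< (≤-trans (m≤n+m _ c) (n≤1+n _)) (rim-sum r)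
  rim-sum (pass d e m ls r) = +-mono-≤-< (≤-trans (m≤n+m _ d) (n≤1+n _)) (rim-sum r)

  strip-sum : ∀ l ls → IsPartition (suc l ∷ ls) → sum (stripRim p (suc l ∷ ls)) ≤ l + sum ls
  strip-sum l ls (d , _ ∷ pos) rewrite sum-nonzero (stripped p (suc l ∷ ls)) = s≤s⁻¹ (rim-sum (rim-view (suc q) l ls d pos))

  nonzero-partition : ∀ xs → Desc xs → IsPartition (nonzero xs)
  nonzero-partition xs d = Linked.filter⁺ (1 ≤?_) (flip ≤-trans) d , all-filter (1 ≤?_) xs

  strip-partition : ∀ λs → IsPartition λs → IsPartition (stripRim p λs)
  strip-partition []           _             = [] , []
  strip-partition (suc l ∷ ls) (d , _ ∷ pos) = nonzero-partition _ (Linked.tail (rim-desc (rim-view (suc q) l ls d pos)))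

  open FuelledMullineux (fuelled p)

  -- Each removal lowers the sum by at least one, so fuel that covers the sum lasts until the
  -- partition is empty, and any excess is immaterial.
  run-fuel : ∀ m n xs → IsPartition xs → sum xs ≤ m → sum xs ≤ n → run m xs ≡ run n xs
  run-fuel zero    zero    xs           _ _ _ = refl
  run-fuel zero    (suc n) []           _ _ _ = trans (run-none []) (sym (run-[] n))
  run-fuel zero    (suc n) (suc x ∷ xs) _ () _
  run-fuel zero    (suc n) (zero ∷ xs)  (_ , () ∷ _)
  run-fuel (suc m) zero    []           _ _ _ = trans (run-[] m) (sym (run-none []))
  run-fuel (suc m) zero    (suc x ∷ xs) _ _ ()
  run-fuel (suc m) zero    (zero ∷ xs)  (_ , () ∷ _)
  run-fuel (suc m) (suc n) []           _ _ _ = trans (run-[] m) (sym (run-[] n))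
  run-fuel (suc m) (suc n) (zero ∷ xs)  (_ , () ∷ _)
  run-fuel (suc m) (suc n) (suc x ∷ xs) part (s≤s ≤m) (s≤s ≤n) = begin
    run (suc m) (suc x ∷ xs)           ≡⟨ run-∷ m (suc x) xs ⟩
    _ ∷ run m (stripRim p (suc x ∷ xs)) ≡⟨ cong (_ ∷_) (run-fuel m n _ (strip-partition _ part)
                                             (≤-trans (strip-sum x xs part) ≤m) (≤-trans (strip-sum x xs part) ≤n)) ⟩
    _ ∷ run n (stripRim p (suc x ∷ xs)) ≡⟨ run-∷ n (suc x) xs ⟨
    run (suc n) (suc x ∷ xs)           ∎
    where open ≡-Reasoning

  mullineux-∷ : ∀ l ls → IsPartition (l ∷ ls) →
    mullineux p (l ∷ ls) ≡ (pRimSize p (l ∷ ls) , length (l ∷ ls)) ∷ mullineux p (stripRim p (l ∷ ls))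
  mullineux-∷ zero    ls (_ , () ∷ _)
  mullineux-∷ (suc l) ls part = begin
    mullineux p (suc l ∷ ls)                      ≡⟨ mullineux≡ (suc l ∷ ls) (suc (l + sum ls)) refl ⟩
    run (suc (l + sum ls)) (suc l ∷ ls)           ≡⟨ run-∷ _ (suc l) ls ⟩
    first ∷ run (l + sum ls) (stripRim p (suc l ∷ ls)) ≡⟨ cong (first ∷_) (run-fuel _ _ _ (strip-partition _ part) (strip-sum l ls part) ≤-refl) ⟩
    first ∷ run (sum (stripRim p (suc l ∷ ls))) (stripRim p (suc l ∷ ls)) ≡⟨ cong (first ∷_) (mullineux≡ (stripRim p (suc l ∷ ls)) _ refl) ⟨
    first ∷ mullineux p (stripRim p (suc l ∷ ls))     ∎
    where
    open ≡-Reasoning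
    first = pRimSize p (suc l ∷ ls) , length (suc l ∷ ls)

  lastColumn : List ℕ → ℤ × ℤ
  lastColumn λs = + pRimSize p λs ℤ.- + length λs , + 1 ℤ.- + length λs

  residueSymbol-∷ : ∀ l ls → IsPartition (l ∷ ls) →
    residueSymbol p (l ∷ ls) ≡ residueSymbol p (stripRim p (l ∷ ls)) ++ lastColumn (l ∷ ls) ∷ []
  residueSymbol-∷ l ls part = trans (cong (λ m → reverse (map column m)) (mullineux-∷ l ls part))
    (unfold-reverse (lastColumn (l ∷ ls)) (map column (mullineux p (stripRim p (l ∷ ls)))))
    where
    column : ℕ × ℕ → ℤ × ℤ
    column ar = + proj₁ ar ℤ.- + proj₂ ar , + 1 ℤ.- + proj₂ ar

  -- One step of p-rim removal.

  EndCond-resp : ∀ {x x′ τ τ′ v} → x ≈ x′ → τ ≈ τ′ → EndCond x τ v → EndCond x′ τ′ v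
  EndCond-resp x≈ τ≈ (inj₁ (x≈0 , inj₁ v≈0)) = inj₁ (≈-trans (≈-sym x≈) x≈0 , inj₁ v≈0)
  EndCond-resp x≈ τ≈ (inj₁ (x≈0 , inj₂ τ≈0)) = inj₁ (≈-trans (≈-sym x≈) x≈0 , inj₂ (≈-trans (≈-sym τ≈) τ≈0))
  EndCond-resp x≈ τ≈ (inj₂ (x≉0 , inj₁ (v≈1 , x≈τ))) =
    inj₂ (x≉0 ∘ ≈-trans x≈ , inj₁ (v≈1 , ≈-trans (≈-sym x≈) (≈-trans x≈τ τ≈)))
  EndCond-resp x≈ τ≈ (inj₂ (x≉0 , inj₂ (τ≈1 , x≈v))) =
    inj₂ (x≉0 ∘ ≈-trans x≈ , inj₂ (≈-trans (≈-sym τ≈) τ≈1 , ≈-trans (≈-sym x≈) x≈v))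

  StrongEnd-resp : ∀ {x x′ τ τ′ v} → x ≈ x′ → τ ≈ τ′ → StrongEnd x τ v → StrongEnd x′ τ′ v
  StrongEnd-resp x≈ τ≈ (inj₁ (x≈0 , inj₁ v≡0)) = inj₁ (≈-trans (≈-sym x≈) x≈0 , inj₁ v≡0)
  StrongEnd-resp x≈ τ≈ (inj₁ (x≈0 , inj₂ (τ≈0 , b))) = inj₁ (≈-trans (≈-sym x≈) x≈0 , inj₂ (≈-trans (≈-sym τ≈) τ≈0 , b))
  StrongEnd-resp x≈ τ≈ (inj₂ (x≉0 , inj₁ (v≈1 , x≈τ))) =
    inj₂ (x≉0 ∘ ≈-trans x≈ , inj₁ (v≈1 , ≈-trans (≈-sym x≈) (≈-trans x≈τ τ≈)))
  StrongEnd-resp x≈ τ≈ (inj₂ (x≉0 , inj₂ (τ≈1 , x≈v))) =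
    inj₂ (x≉0 ∘ ≈-trans x≈ , inj₂ (≈-trans (≈-sym τ≈) τ≈1 , ≈-trans (≈-sym x≈) x≈v))

  StrongEnd⇒EndCond : ∀ {x τ v} → StrongEnd x τ v → EndCond x τ v
  StrongEnd⇒EndCond (inj₁ (x≈0 , inj₁ refl))      = inj₁ (x≈0 , inj₁ ≈-refl)
  StrongEnd⇒EndCond (inj₁ (x≈0 , inj₂ (τ≈0 , _))) = inj₁ (x≈0 , inj₂ τ≈0)
  StrongEnd⇒EndCond (inj₂ h)                      = inj₂ h

  nonzero-positive : ∀ {xs} → All (0 <_) xs → nonzero xs ≡ xs
  nonzero-positive = filter-all (1 ≤?_)

  -- `rows` keeps the rows that became empty. Its length is still `k`, so both partitions start from
  -- the same requirement α + `k`, and the `v` lost rows are the trailing beads seen by the final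
  -- condition.
  module StripRim (l : ℕ) (ls : List ℕ) (part : IsPartition (suc l ∷ ls)) where
    μ rows : List ℕ
    μ = suc l ∷ ls
    rows = stripped p μ
    k k′ v a : ℕ
    k  = length μ
    k′ = length (stripRim p μ)
    v  = length rows ∸ k′
    a  = pRimSize p μ
    w : List Bool
    w = true ∷ wordFrom (suc l) ls

    view : Rim (suc q) l ls (rimRemoved p p μ) rows
    view = rim-view (suc q) l ls (proj₁ part) (All.tail (proj₂ part))

    length-rows : length rows ≡ k
    length-rows = rim-length view

    k≡v+k′ : k ≡ v + k′
    k≡v+k′ = trans (sym length-rows) (sym (m∸n+n≡m (length-filter (1 ≤?_) rows)))

    word-μ : wordFrom (suc l) μ ≡ w
    word-μ rewrite n∸n≡0 l = refl

    word-rows : idle w ≡ wordFrom (suc l) rows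
    word-rows = trans (cong (false ∷_) (rim-word view)) (sym (wordFrom-gaps 1 l rows (rim-desc view)))

    leader≈ : lastLeader w ≈ a
    leader≈ = ≈-sym (≈-trans (rim-size view ≤-refl) (≈-trans (≈-reflexive (+-comm p _)) (+p≈ _)))

    desc-rows : Desc (suc l ∷ rows)
    desc-rows = Desc-weaken (n≤1+n l) (rim-desc view)

    nonzero-μ : nonzero μ ≡ μ
    nonzero-μ = nonzero-positive (proj₂ part)

    js⇔chain : ∀ F → (∀ {τ τ′ v} → τ ≈ τ′ → F τ v → F τ′ v) → ∀ α →
      Chain F (α + k) w ⇔ (IsJS p μ (+ α) × F (α + k + k) (k ∸ k))
    js⇔chain F F-resp α = subst₂ (λ w rs → Chain F (α + k) w ⇔ (IsJS p rs (+ α) × F (α + k + length rs) (k ∸ length rs)))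
      word-μ nonzero-μ (js⇔ F F-resp α (suc l) l ls (proj₁ part))

    js⇒chain : ∀ α → IsJS p μ (+ α) → Chain (StrongEnd a) (α + k) (wordFrom (suc l) rows)
    js⇒chain α js = Chain-map {StrongEnd (lastLeader w)} {StrongEnd a}
      (StrongEnd-resp leader≈ ≈-refl) (α + k) (wordFrom (suc l) rows)
      (subst (Chain (StrongEnd (lastLeader w)) (α + k)) word-rows
      (idle-preserves (α + k) w (from (js⇔chain closed (λ _ c → c) α) (js , n∸n≡0 k))))

    chain⇒js : ∀ α → PRegular p μ → Chain (EndCond a) (α + k) (wordFrom (suc l) rows) → IsJS p μ (+ α)
    chain⇒js α reg g = proj₁ (to (js⇔chain closed (λ _ c → c) α) (idle-reflects (α + k) w
      (subst Regular word-μ (regular-word (suc l) l ls (proj₁ part) (All.tail (proj₂ part)) reg))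
      (subst (Chain (EndCond (lastLeader w)) (α + k)) (sym word-rows)
        (Chain-map {EndCond a} {EndCond (lastLeader w)} (EndCond-resp (≈-sym leader≈) ≈-refl) (α + k) (wordFrom (suc l) rows) g))))

    strip⇔ : ∀ F → (∀ {τ τ′ v} → τ ≈ τ′ → F τ v → F τ′ v) → ∀ α → stripRim p μ ≢ [] →
      Chain F (α + k) (wordFrom (suc l) rows) ⇔ (IsJS p (stripRim p μ) (+ α) × F (α + k + k′) v)
    strip⇔ F F-resp α ne = subst (λ n → Chain F (α + n) (wordFrom (suc l) rows) ⇔ (IsJS p (stripRim p μ) (+ α) × F (α + n + k′) v))
      length-rows (js⇔′ F F-resp α (suc l) rows (Linked.tail desc-rows) ne)

    -- Passing to the stripped partition yields the sharper `StrongEnd`, weakened afterwards.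
    -- Lifting works from `EndCond`, all that a column known modulo p can provide.
    js-step : ∀ α → PRegular p μ → stripRim p μ ≢ [] →
      IsJS p μ (+ α) ⇔ (IsJS p (stripRim p μ) (+ α) × EndCond a (α + k + k′) v)
    js-step α reg ne = mk⇔
      (λ js → let js′ , ec = to (strip⇔ (StrongEnd a) (StrongEnd-resp ≈-refl) α ne) (js⇒chain α js) in js′ , StrongEnd⇒EndCond ec)
      (λ h → chain⇒js α reg (from (strip⇔ (EndCond a) (EndCond-resp ≈-refl) α ne) h))

    -- When nothing remains, all `k` rows are trailing beads and no run is left to test; the final
    -- condition applies at the initial requirement α + `k`.
    js-base : ∀ α → stripRim p μ ≡ [] → IsJS p μ (+ α) → StrongEnd a (α + k) k
    js-base α nil js = subst (StrongEnd a (α + k)) length-rows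
      (subst (λ A → A) (Chain-zeros (StrongEnd a) (StrongEnd-resp ≈-refl) (α + k) (suc l) rows desc-rows nil) (js⇒chain α js))

    js-base⁻ : ∀ α → PRegular p μ → stripRim p μ ≡ [] → EndCond a (α + k) k → IsJS p μ (+ α)
    js-base⁻ α reg nil ec = chain⇒js α reg
      (subst (λ A → A) (sym (Chain-zeros (EndCond a) (EndCond-resp ≈-refl) (α + k) (suc l) rows desc-rows nil))
        (subst (EndCond a (α + k)) (sym length-rows) ec))

  _≈?_ : ∀ m n → Dec (m ≈ n)
  m ≈? n = map′ mod≡ (λ { (mod≡ eq) → eq }) (m % p ≟ n % p)

  -- The admissible last columns.

  Extension : ℕ → ℤ → ℤ → ℤ → Set
  Extension α yₖ x y =
    (x ≋ + α ℤ.+ + 1 ℤ.- yₖ × y ≋ yₖ ℤ.- + 1 × ¬ + 2 ℤ.* yₖ ≋ + α ℤ.+ + 3)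
    ⊎ (x ≋ yₖ ℤ.- + 1 × y ≋ + α ℤ.+ + 1 ℤ.- yₖ × ¬ + 2 ℤ.* yₖ ≋ + α ℤ.+ + 1)
    ⊎ (x ≋ yₖ ℤ.- + 1 × y ≋ yₖ)
    ⊎ (x ≋ + α ℤ.+ + 1 ℤ.- yₖ × y ≋ + α ℤ.+ + 2 ℤ.- yₖ)

  -- λ has k rows, μ has v + k rows and its p-rim has a nodes.
  module _ (α a v k : ℕ) where
    private
      τ : ℕ
      τ = α + (v + k) + k
      x y yₖ A V K L : ℤ
      x  = + a ℤ.- + (v + k)
      y  = + 1 ℤ.- + (v + k)
      yₖ = + 1 ℤ.- + k
      A = + α
      V = + v
      K = + k
      L = + a

    -- Since `yₖ` is 1 - `k`, the four cases of `EndCond` become the four columns, the singular ones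
    -- being those with `a ≈ 0`. In both regular cases the excluded congruence for 2`yₖ` amounts to
    -- `a ≈ 0`.
    extension⁺ : EndCond a τ v → Extension α yₖ x y
    extension⁺ (inj₁ (a≈0 , inj₁ v≈0)) = inj₂ (inj₂ (inj₁
      ( (combine (+ 1) (ℤ.- + 1) (e₁ L V K) (≈⇒≋ a≈0) (≈⇒≋ v≈0))
      , (scale (ℤ.- + 1) (e₂ V K) (≈⇒≋ v≈0)))))
      where
      e₁ : ∀ L V K → (L ℤ.- (V ℤ.+ K)) ℤ.- ((+ 1 ℤ.- K) ℤ.- + 1) ≡ + 1 ℤ.* (L ℤ.- + 0) ℤ.+ (ℤ.- + 1) ℤ.* (V ℤ.- + 0)
      e₁ = ℤSolver.solve-∀
      e₂ : ∀ V K → (+ 1 ℤ.- (V ℤ.+ K)) ℤ.- (+ 1 ℤ.- K) ≡ (ℤ.- + 1) ℤ.* (V ℤ.- + 0)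
      e₂ = ℤSolver.solve-∀
    extension⁺ (inj₁ (a≈0 , inj₂ τ≈0)) = inj₂ (inj₂ (inj₂
      ( (combine (+ 1) (ℤ.- + 1) (e₁ A L V K) (≈⇒≋ a≈0) (≈⇒≋ τ≈0))
      , (scale (ℤ.- + 1) (e₂ A V K) (≈⇒≋ τ≈0)))))
      where
      e₁ : ∀ A L V K → (L ℤ.- (V ℤ.+ K)) ℤ.- (A ℤ.+ + 1 ℤ.- (+ 1 ℤ.- K))
         ≡ + 1 ℤ.* (L ℤ.- + 0) ℤ.+ (ℤ.- + 1) ℤ.* ((A ℤ.+ (V ℤ.+ K) ℤ.+ K) ℤ.- + 0)
      e₁ = ℤSolver.solve-∀
      e₂ : ∀ A V K → (+ 1 ℤ.- (V ℤ.+ K)) ℤ.- (A ℤ.+ + 2 ℤ.- (+ 1 ℤ.- K)) ≡ (ℤ.- + 1) ℤ.* ((A ℤ.+ (V ℤ.+ K) ℤ.+ K) ℤ.- + 0)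
      e₂ = ℤSolver.solve-∀
    extension⁺ (inj₂ (a≉0 , inj₁ (v≈1 , a≈τ))) = inj₁
      ( (scale (+ 1) (e₁ A L V K) (≈⇒≋ a≈τ))
      , (scale (ℤ.- + 1) (e₂ V K) (≈⇒≋ v≈1))
      , λ c → a≉0 (≋⇒≈ (combine₃ (+ 1) (+ 1) (ℤ.- + 1) (e₃ A L V K) (≈⇒≋ a≈τ) (≈⇒≋ v≈1) c)))
      where
      e₁ : ∀ A L V K → (L ℤ.- (V ℤ.+ K)) ℤ.- (A ℤ.+ + 1 ℤ.- (+ 1 ℤ.- K)) ≡ + 1 ℤ.* (L ℤ.- (A ℤ.+ (V ℤ.+ K) ℤ.+ K))
      e₁ = ℤSolver.solve-∀
      e₂ : ∀ V K → (+ 1 ℤ.- (V ℤ.+ K)) ℤ.- ((+ 1 ℤ.- K) ℤ.- + 1) ≡ (ℤ.- + 1) ℤ.* (V ℤ.- + 1)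
      e₂ = ℤSolver.solve-∀
      e₃ : ∀ A L V K → L ℤ.- + 0 ≡ + 1 ℤ.* (L ℤ.- (A ℤ.+ (V ℤ.+ K) ℤ.+ K)) ℤ.+ + 1 ℤ.* (V ℤ.- + 1)
                                   ℤ.+ (ℤ.- + 1) ℤ.* (+ 2 ℤ.* (+ 1 ℤ.- K) ℤ.- (A ℤ.+ + 3))
      e₃ = ℤSolver.solve-∀
    extension⁺ (inj₂ (a≉0 , inj₂ (τ≈1 , a≈v))) = inj₂ (inj₁
      ( (scale (+ 1) (e₁ L V K) (≈⇒≋ a≈v))
      , (scale (ℤ.- + 1) (e₂ A V K) (≈⇒≋ τ≈1))
      , λ c → a≉0 (≋⇒≈ (combine₃ (+ 1) (+ 1) (+ 1) (e₃ A L V K) (≈⇒≋ a≈v) (≈⇒≋ τ≈1) c))))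
      where
      e₁ : ∀ L V K → (L ℤ.- (V ℤ.+ K)) ℤ.- ((+ 1 ℤ.- K) ℤ.- + 1) ≡ + 1 ℤ.* (L ℤ.- V)
      e₁ = ℤSolver.solve-∀
      e₂ : ∀ A V K → (+ 1 ℤ.- (V ℤ.+ K)) ℤ.- (A ℤ.+ + 1 ℤ.- (+ 1 ℤ.- K)) ≡ (ℤ.- + 1) ℤ.* ((A ℤ.+ (V ℤ.+ K) ℤ.+ K) ℤ.- + 1)
      e₂ = ℤSolver.solve-∀
      e₃ : ∀ A L V K → L ℤ.- + 0 ≡ + 1 ℤ.* (L ℤ.- V) ℤ.+ + 1 ℤ.* ((A ℤ.+ (V ℤ.+ K) ℤ.+ K) ℤ.- + 1)
                                   ℤ.+ + 1 ℤ.* (+ 2 ℤ.* (+ 1 ℤ.- K) ℤ.- (A ℤ.+ + 1))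
      e₃ = ℤSolver.solve-∀

    extension⁻ : Extension α yₖ x y → EndCond a τ v
    extension⁻ (inj₁ (cx , cy , ¬c)) = inj₂ (a≉0 , inj₁ (≋⇒≈ v≋1 , ≋⇒≈ a≋τ))
      where
      e₁ : ∀ A L V K → L ℤ.- (A ℤ.+ (V ℤ.+ K) ℤ.+ K) ≡ + 1 ℤ.* ((L ℤ.- (V ℤ.+ K)) ℤ.- (A ℤ.+ + 1 ℤ.- (+ 1 ℤ.- K)))
      e₁ = ℤSolver.solve-∀
      e₂ : ∀ V K → V ℤ.- + 1 ≡ (ℤ.- + 1) ℤ.* ((+ 1 ℤ.- (V ℤ.+ K)) ℤ.- ((+ 1 ℤ.- K) ℤ.- + 1))
      e₂ = ℤSolver.solve-∀
      e₃ : ∀ A L V K → + 2 ℤ.* (+ 1 ℤ.- K) ℤ.- (A ℤ.+ + 3) ≡ + 1 ℤ.* (L ℤ.- (A ℤ.+ (V ℤ.+ K) ℤ.+ K)) ℤ.+ + 1 ℤ.* (V ℤ.- + 1)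
                                   ℤ.+ (ℤ.- + 1) ℤ.* (L ℤ.- + 0)
      e₃ = ℤSolver.solve-∀
      a≋τ : + a ≋ + τ
      a≋τ = scale (+ 1) (e₁ A L V K) cx
      v≋1 : + v ≋ + 1
      v≋1 = scale (ℤ.- + 1) (e₂ V K) cy
      a≉0 : ¬ a ≈ 0
      a≉0 a≈0 = ¬c ((combine₃ (+ 1) (+ 1) (ℤ.- + 1) (e₃ A L V K) a≋τ v≋1 (≈⇒≋ a≈0)))
    extension⁻ (inj₂ (inj₁ (cx , cy , ¬c))) = inj₂ (a≉0 , inj₂ (≋⇒≈ τ≋1 , ≋⇒≈ a≋v))
      where
      e₁ : ∀ L V K → L ℤ.- V ≡ + 1 ℤ.* ((L ℤ.- (V ℤ.+ K)) ℤ.- ((+ 1 ℤ.- K) ℤ.- + 1))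
      e₁ = ℤSolver.solve-∀
      e₂ : ∀ A V K → (A ℤ.+ (V ℤ.+ K) ℤ.+ K) ℤ.- + 1 ≡ (ℤ.- + 1) ℤ.* ((+ 1 ℤ.- (V ℤ.+ K)) ℤ.- (A ℤ.+ + 1 ℤ.- (+ 1 ℤ.- K)))
      e₂ = ℤSolver.solve-∀
      e₃ : ∀ A L V K → + 2 ℤ.* (+ 1 ℤ.- K) ℤ.- (A ℤ.+ + 1) ≡ (ℤ.- + 1) ℤ.* (L ℤ.- V) ℤ.+ (ℤ.- + 1) ℤ.* ((A ℤ.+ (V ℤ.+ K) ℤ.+ K) ℤ.- + 1)
                                   ℤ.+ + 1 ℤ.* (L ℤ.- + 0)
      e₃ = ℤSolver.solve-∀
      a≋v : + a ≋ + v
      a≋v = scale (+ 1) (e₁ L V K) cx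
      τ≋1 : + τ ≋ + 1
      τ≋1 = scale (ℤ.- + 1) (e₂ A V K) cy
      a≉0 : ¬ a ≈ 0
      a≉0 a≈0 = ¬c ((combine₃ (ℤ.- + 1) (ℤ.- + 1) (+ 1) (e₃ A L V K) a≋v τ≋1 (≈⇒≋ a≈0)))
    extension⁻ (inj₂ (inj₂ (inj₁ (cx , cy)))) = inj₁ (≋⇒≈ a≋0 , inj₁ (≋⇒≈ v≋0))
      where
      e₁ : ∀ L V K → L ℤ.- + 0 ≡ + 1 ℤ.* ((L ℤ.- (V ℤ.+ K)) ℤ.- ((+ 1 ℤ.- K) ℤ.- + 1)) ℤ.+ + 1 ℤ.* (V ℤ.- + 0)
      e₁ = ℤSolver.solve-∀
      e₂ : ∀ V K → V ℤ.- + 0 ≡ (ℤ.- + 1) ℤ.* ((+ 1 ℤ.- (V ℤ.+ K)) ℤ.- (+ 1 ℤ.- K))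
      e₂ = ℤSolver.solve-∀
      v≋0 : + v ≋ + 0
      v≋0 = scale (ℤ.- + 1) (e₂ V K) cy
      a≋0 : + a ≋ + 0
      a≋0 = combine (+ 1) (+ 1) (e₁ L V K) cx v≋0
    extension⁻ (inj₂ (inj₂ (inj₂ (cx , cy)))) = inj₁ (≋⇒≈ a≋0 , inj₂ (≋⇒≈ τ≋0))
      where
      e₁ : ∀ A L V K → L ℤ.- + 0 ≡ + 1 ℤ.* ((L ℤ.- (V ℤ.+ K)) ℤ.- (A ℤ.+ + 1 ℤ.- (+ 1 ℤ.- K))) ℤ.+ + 1 ℤ.* ((A ℤ.+ (V ℤ.+ K) ℤ.+ K) ℤ.- + 0)
      e₁ = ℤSolver.solve-∀
      e₂ : ∀ A V K → (A ℤ.+ (V ℤ.+ K) ℤ.+ K) ℤ.- + 0 ≡ (ℤ.- + 1) ℤ.* ((+ 1 ℤ.- (V ℤ.+ K)) ℤ.- (A ℤ.+ + 2 ℤ.- (+ 1 ℤ.- K)))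
      e₂ = ℤSolver.solve-∀
      τ≋0 : + τ ≋ + 0
      τ≋0 = scale (ℤ.- + 1) (e₂ A V K) cy
      a≋0 : + a ≋ + 0
      a≋0 = combine (+ 1) (+ 1) (e₁ A L V K) cx τ≋0

  Base : ℕ → ℤ → ℤ → Set
  Base α x y =
    (x ≋ + 0 × y ≋ + α × ¬ + α ≋ + 1)
    ⊎ (x ≋ + α × y ≋ + 0)
    ⊎ (x ≋ + α × y ≋ + α ℤ.+ + 1 × ¬ + α ≋ + 0)

  module _ (α a k : ℕ) where
    private
      x y A K L : ℤ
      x = + a ℤ.- + k
      y = + 1 ℤ.- + k
      A = + α
      K = + k
      L = + a

    base⁺ : 0 < k → StrongEnd a (α + k) k → Base α x y
    base⁺ 0<k (inj₁ (a≈0 , inj₁ refl)) = contradiction refl (<⇒≢ 0<k)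
    base⁺ 0<k (inj₁ (a≈0 , inj₂ (τ≈0 , _ , k<p))) = inj₂ (inj₂
      ( combine (+ 1) (ℤ.- + 1) (e₁ A L K) (≈⇒≋ a≈0) (≈⇒≋ τ≈0)
      , scale (ℤ.- + 1) (e₂ A K) (≈⇒≋ τ≈0)
      -- Together with α + `k` ≈ 0, α ≈ 0 would give `k` ≈ 0; the bounds on `k` in `StrongEnd`
      -- exclude this.
      , λ c → ≈-distinct 0<k k<p (≈-sym (≋⇒≈ (combine (+ 1) (ℤ.- + 1) (e₃ A K) (≈⇒≋ τ≈0) c)))))
      where
      e₁ : ∀ A L K → (L ℤ.- K) ℤ.- A ≡ + 1 ℤ.* (L ℤ.- + 0) ℤ.+ (ℤ.- + 1) ℤ.* (A ℤ.+ K ℤ.- + 0)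
      e₁ = ℤSolver.solve-∀
      e₂ : ∀ A K → (+ 1 ℤ.- K) ℤ.- (A ℤ.+ + 1) ≡ (ℤ.- + 1) ℤ.* (A ℤ.+ K ℤ.- + 0)
      e₂ = ℤSolver.solve-∀
      e₃ : ∀ A K → K ℤ.- + 0 ≡ + 1 ℤ.* (A ℤ.+ K ℤ.- + 0) ℤ.+ (ℤ.- + 1) ℤ.* (A ℤ.- + 0)
      e₃ = ℤSolver.solve-∀
    base⁺ 0<k (inj₂ (a≉0 , inj₁ (k≈1 , a≈τ))) = inj₂ (inj₁
      ( scale (+ 1) (e₁ A L K) (≈⇒≋ a≈τ)
      , scale (ℤ.- + 1) (e₂ K) (≈⇒≋ k≈1)))
      where
      e₁ : ∀ A L K → (L ℤ.- K) ℤ.- A ≡ + 1 ℤ.* (L ℤ.- (A ℤ.+ K))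
      e₁ = ℤSolver.solve-∀
      e₂ : ∀ K → (+ 1 ℤ.- K) ℤ.- + 0 ≡ (ℤ.- + 1) ℤ.* (K ℤ.- + 1)
      e₂ = ℤSolver.solve-∀
    base⁺ 0<k (inj₂ (a≉0 , inj₂ (τ≈1 , a≈k))) = inj₁
      ( scale (+ 1) (e₁ L K) (≈⇒≋ a≈k)
      , scale (ℤ.- + 1) (e₂ A K) (≈⇒≋ τ≈1)
      , λ c → a≉0 (≋⇒≈ (combine₃ (+ 1) (+ 1) (ℤ.- + 1) (e₃ A L K) (≈⇒≋ a≈k) (≈⇒≋ τ≈1) c)))
      where
      e₁ : ∀ L K → (L ℤ.- K) ℤ.- + 0 ≡ + 1 ℤ.* (L ℤ.- K)
      e₁ = ℤSolver.solve-∀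
      e₂ : ∀ A K → (+ 1 ℤ.- K) ℤ.- A ≡ (ℤ.- + 1) ℤ.* (A ℤ.+ K ℤ.- + 1)
      e₂ = ℤSolver.solve-∀
      e₃ : ∀ A L K → L ℤ.- + 0 ≡ + 1 ℤ.* (L ℤ.- K) ℤ.+ + 1 ℤ.* (A ℤ.+ K ℤ.- + 1) ℤ.+ (ℤ.- + 1) ℤ.* (A ℤ.- + 1)
      e₃ = ℤSolver.solve-∀

    base⁻ : Base α x y → EndCond a (α + k) k
    base⁻ (inj₁ (cx , cy , ¬c)) = inj₂ (a≉0 , inj₂ (≋⇒≈ τ≋1 , ≋⇒≈ a≋k))
      where
      e₁ : ∀ L K → L ℤ.- K ≡ + 1 ℤ.* ((L ℤ.- K) ℤ.- + 0)
      e₁ = ℤSolver.solve-∀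
      e₂ : ∀ A K → A ℤ.+ K ℤ.- + 1 ≡ (ℤ.- + 1) ℤ.* ((+ 1 ℤ.- K) ℤ.- A)
      e₂ = ℤSolver.solve-∀
      e₃ : ∀ A L K → A ℤ.- + 1 ≡ + 1 ℤ.* (L ℤ.- K) ℤ.+ + 1 ℤ.* (A ℤ.+ K ℤ.- + 1) ℤ.+ (ℤ.- + 1) ℤ.* (L ℤ.- + 0)
      e₃ = ℤSolver.solve-∀
      a≋k : + a ≋ + k
      a≋k = scale (+ 1) (e₁ L K) cx
      τ≋1 : + (α + k) ≋ + 1
      τ≋1 = scale (ℤ.- + 1) (e₂ A K) cy
      a≉0 : ¬ a ≈ 0
      a≉0 a≈0 = ¬c (combine₃ (+ 1) (+ 1) (ℤ.- + 1) (e₃ A L K) a≋k τ≋1 (≈⇒≋ a≈0))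
    -- The column (α, 0) may be singular or regular: it yields α + `k` ≈ 0 if `a ≈ 0`, and `k` ≈ 1
    -- with `a` ≈ α + `k` otherwise.
    base⁻ (inj₂ (inj₁ (cx , cy))) with a ≈? 0
    ... | yes a≈0 = inj₁ (a≈0 , inj₂ (≋⇒≈ (combine (ℤ.- + 1) (+ 1) (e₁ A L K) cx (≈⇒≋ a≈0))))
      where
      e₁ : ∀ A L K → A ℤ.+ K ℤ.- + 0 ≡ (ℤ.- + 1) ℤ.* ((L ℤ.- K) ℤ.- A) ℤ.+ + 1 ℤ.* (L ℤ.- + 0)
      e₁ = ℤSolver.solve-∀
    ... | no a≉0 = inj₂ (a≉0 , inj₁ (≋⇒≈ (scale (ℤ.- + 1) (e₂ K) cy) , ≋⇒≈ (scale (+ 1) (e₁ A L K) cx)))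
      where
      e₁ : ∀ A L K → L ℤ.- (A ℤ.+ K) ≡ + 1 ℤ.* ((L ℤ.- K) ℤ.- A)
      e₁ = ℤSolver.solve-∀
      e₂ : ∀ K → K ℤ.- + 1 ≡ (ℤ.- + 1) ℤ.* ((+ 1 ℤ.- K) ℤ.- + 0)
      e₂ = ℤSolver.solve-∀
    base⁻ (inj₂ (inj₂ (cx , cy , _))) =
      inj₁ (≋⇒≈ (combine (+ 1) (ℤ.- + 1) (e₁ A L K) cx cy) , inj₂ (≋⇒≈ (scale (ℤ.- + 1) (e₂ A K) cy)))
      where
      e₁ : ∀ A L K → L ℤ.- + 0 ≡ + 1 ℤ.* ((L ℤ.- K) ℤ.- A) ℤ.+ (ℤ.- + 1) ℤ.* ((+ 1 ℤ.- K) ℤ.- (A ℤ.+ + 1))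
      e₁ = ℤSolver.solve-∀
      e₂ : ∀ A K → A ℤ.+ K ℤ.- + 0 ≡ (ℤ.- + 1) ℤ.* ((+ 1 ℤ.- K) ℤ.- (A ℤ.+ + 1))
      e₂ = ℤSolver.solve-∀

  -- Canonical representatives of residues.

  ≋-sym : ∀ {a b} → a ≋ b → b ≋ a
  ≋-sym {a} {b} = scale (ℤ.- + 1) (arith a b)
    where
    arith : ∀ a b → b ℤ.- a ≡ (ℤ.- + 1) ℤ.* (a ℤ.- b)
    arith = ℤSolver.solve-∀

  ≋-trans : ∀ {a b c} → a ≋ b → b ≋ c → a ≋ c
  ≋-trans {a} {b} {c} = combine (+ 1) (+ 1) (arith a b c)
    where
    arith : ∀ a b c → a ℤ.- c ≡ + 1 ℤ.* (a ℤ.- b) ℤ.+ + 1 ℤ.* (b ℤ.- c)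
    arith = ℤSolver.solve-∀

  p≋0 : + p ≋ + 0
  p≋0 = ≈⇒≋ (+p≈ 0)

  remainder≋ : ∀ z r d → z ≡ + r ℤ.+ d ℤ.* + p → + r ≋ z
  remainder≋ z r d eq = scale (ℤ.- d) (trans (cong (λ t → + r ℤ.- t) eq) (arith (+ r) d (+ p))) p≋0
    where
    arith : ∀ r d n → r ℤ.- (r ℤ.+ d ℤ.* n) ≡ (ℤ.- d) ℤ.* (n ℤ.- + 0)
    arith = ℤSolver.solve-∀

  small-unique : ∀ {r r′} → r < p → r′ < p → + r ≋ + r′ → r ≡ r′
  small-unique r<p r′<p r≋r′ = trans (sym (m<n⇒m%n≡m r<p)) (trans (_≈_.%≡% (≋⇒≈ r≋r′)) (m<n⇒m%n≡m r′<p))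

  res-< : ∀ z → res p z < p
  res-< z = ℤ.n%ℕd<d z p

  res≋ : ∀ z → + res p z ≋ z
  res≋ z = remainder≋ z (res p z) (z ℤ./ℕ p) (ℤ.a≡a%ℕn+[a/ℕn]*n z p)

  res-cong : ∀ {z z′} → z ≋ z′ → res p z ≡ res p z′
  res-cong {z} {z′} z≋ = small-unique (res-< z) (res-< z′) (≋-trans (res≋ z) (≋-trans z≋ (≋-sym (res≋ z′))))

  -- End values

  -- Only periodicity of `δ` matters here; later it is the indicator of one residue, and `g` is the
  -- joint weight of the two entries of the Mullineux sequence that come from one x.
  module Potential (δ : ℤ → ℤ) (δ-cong : ∀ {z z′} → z ≋ z′ → δ z ≡ δ z′) where

    g : ℤ → ℤ
    g z = δ z ℤ.- δ (z ℤ.+ + 1)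

    shift : ∀ s {m n} → m ≈ n → s ℤ.+ + m ≋ s ℤ.+ + n
    shift s {m} {n} m≈n = scale (+ 1) (arith s (+ m) (+ n)) (≈⇒≋ m≈n)
      where
      arith : ∀ s m n → (s ℤ.+ m) ℤ.- (s ℤ.+ n) ≡ + 1 ℤ.* (m ℤ.- n)
      arith = ℤSolver.solve-∀

    g-shift : ∀ s {m n} → m ≈ n → g (s ℤ.+ + m) ≡ g (s ℤ.+ + n)
    g-shift s {m} {n} m≈n = cong₂ ℤ._-_ (δ-cong (shift s m≈n))
      (δ-cong (scale (+ 1) (arith (s ℤ.+ + m) (s ℤ.+ + n)) (shift s m≈n)))
      where
      arith : ∀ a b → (a ℤ.+ + 1) ℤ.- (b ℤ.+ + 1) ≡ + 1 ℤ.* (a ℤ.- b)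
      arith = ℤSolver.solve-∀

    δ-suc : ∀ s n → δ (s ℤ.+ + n ℤ.+ + 1) ≡ δ (s ℤ.+ + suc n)
    δ-suc s n = cong δ (trans (ℤ.+-assoc s (+ n) (+ 1)) (cong (λ m → s ℤ.+ + m) (+-comm n 1)))

    wsum : ℤ → List Bool → ℤ
    wsum s []          = + 0
    wsum s (false ∷ w) = wsum s w
    wsum s (true  ∷ w) = g (s ℤ.+ + length w) ℤ.+ wsum s w

    -- By periodicity a leader falling by p contributes the same before and after. Only the leader
    -- of an incomplete last segment changes its residue, moving from `lastLeader w` to 0; if that
    -- segment is complete, `lastLeader w` is 0 and the correction vanishes.
    wsum-idle : ∀ s w → Ends-in-gap false w → wsum s (idle w) ≡ wsum s w ℤ.+ (g s ℤ.- g (s ℤ.+ + lastLeader w))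
    -- The leader `L` was taken out above this word and comes back within it, whence the extra term
    -- at `L`.
    wsum-copy : ∀ s c L y w → c + suc L ≡ suc (length w) + p → Ends-in-gap y w →
      wsum s (copy c (y ∷ w)) ≡ wsum s (y ∷ w) ℤ.+ (g (s ℤ.+ + L) ℤ.+ (g s ℤ.- g (s ℤ.+ + lastLeaderᶜ c (y ∷ w))))
    wsum-idle s []          h = trans (sym (ℤ.+-inverseʳ (g s))) (trans (cong (λ z → g s ℤ.- g z) (sym (ℤ.+-identityʳ s))) (sym (ℤ.+-identityˡ _)))
    wsum-idle s (false ∷ w) h = wsum-idle s w h
    wsum-idle s (true ∷ y ∷ w) h = trans (wsum-copy s (suc q) (length (y ∷ w)) y w (start _) h)
      (arith (wsum s (y ∷ w)) (g (s ℤ.+ + length (y ∷ w))) _)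
      where
      arith : ∀ a b c → a ℤ.+ (b ℤ.+ c) ≡ (b ℤ.+ a) ℤ.+ c
      arith = ℤSolver.solve-∀
    wsum-copy s zero L false w inv h = begin
      g (s ℤ.+ + length (idle w)) ℤ.+ wsum s (idle w)
        ≡⟨ cong₂ (λ n t → g (s ℤ.+ + n) ℤ.+ t) (length-idle w) (wsum-idle s w h) ⟩
      g (s ℤ.+ + length w) ℤ.+ (wsum s w ℤ.+ _)
        ≡⟨ cong (λ t → t ℤ.+ (wsum s w ℤ.+ _)) (g-shift s (≈-sym (target≈ {L} inv))) ⟩
      g (s ℤ.+ + L) ℤ.+ (wsum s w ℤ.+ (g s ℤ.- g (s ℤ.+ + lastLeader w)))
        ≡⟨ arith (wsum s w) (g (s ℤ.+ + L)) _ ⟩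
      wsum s w ℤ.+ (g (s ℤ.+ + L) ℤ.+ _) ∎
      where
      open ≡-Reasoning
      arith : ∀ a b c → b ℤ.+ (a ℤ.+ c) ≡ a ℤ.+ (b ℤ.+ c)
      arith = ℤSolver.solve-∀
    wsum-copy s zero L true (y ∷ w) inv h = begin
      g (s ℤ.+ + length (copy (suc q) (y ∷ w))) ℤ.+ wsum s (copy (suc q) (y ∷ w))
        ≡⟨ cong₂ (λ n t → g (s ℤ.+ + n) ℤ.+ t) (length-copy (suc q) (y ∷ w)) (wsum-copy s (suc q) _ y w (start _) h) ⟩
      g (s ℤ.+ + length (y ∷ w)) ℤ.+ (wsum s (y ∷ w) ℤ.+ (g (s ℤ.+ + length (y ∷ w)) ℤ.+ _))
        ≡⟨ cong (λ t → g (s ℤ.+ + length (y ∷ w)) ℤ.+ (wsum s (y ∷ w) ℤ.+ (t ℤ.+ _))) (g-shift s (≈-sym (target≈ {L} inv))) ⟩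
      g (s ℤ.+ + length (y ∷ w)) ℤ.+ (wsum s (y ∷ w) ℤ.+ (g (s ℤ.+ + L) ℤ.+ _))
        ≡⟨ ℤ.+-assoc (g (s ℤ.+ + length (y ∷ w))) _ _ ⟨
      g (s ℤ.+ + length (y ∷ w)) ℤ.+ wsum s (y ∷ w) ℤ.+ (g (s ℤ.+ + L) ℤ.+ _) ∎
      where open ≡-Reasoning
    wsum-copy s (suc c) L false [] inv h rewrite last≡leader {c} {L} (suc-injective inv) | ℤ.+-identityʳ s =
      arith (g s) (g (s ℤ.+ + L))
      where
      arith : ∀ a b → a ℤ.+ + 0 ≡ + 0 ℤ.+ (b ℤ.+ (a ℤ.- b))
      arith = ℤSolver.solve-∀
    wsum-copy s (suc c) L false (z ∷ w) inv h = wsum-copy s c L z w (suc-injective inv) h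
    wsum-copy s (suc c) L true  (z ∷ w) inv h rewrite length-copy c (z ∷ w) | wsum-copy s c L z w (suc-injective inv) h =
      sym (ℤ.+-assoc (g (s ℤ.+ + length (z ∷ w))) _ _)

    -- Started at c = 0, this is Σ g(λᵢ − i) − δ(− number of rows).
    rsum : ℤ → List ℕ → ℤ
    rsum c []       = ℤ.- δ c
    rsum c (r ∷ rs) = g (c ℤ.- + 1 ℤ.+ + r) ℤ.+ rsum (c ℤ.- + 1) rs

    -- An empty row adds δ(c - 1) - δ(c), which turns the closing term -δ(c - 1) into -δ(c). Thanks
    -- to that term the sum ignores rows that have become empty.
    rsum-zeros : ∀ c rs → Desc (0 ∷ rs) → rsum c rs ≡ ℤ.- δ c
    rsum-zeros c []       d         = refl
    rsum-zeros c (0 ∷ rs) (z≤n ∷ d) rewrite rsum-zeros (c ℤ.- + 1) rs d | ℤ.+-identityʳ (c ℤ.- + 1) =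
      trans (cong (λ z → δ (c ℤ.- + 1) ℤ.- δ z ℤ.+ ℤ.- δ (c ℤ.- + 1)) (cancel c)) (arith (δ (c ℤ.- + 1)) (δ c))
      where
      cancel : ∀ c → c ℤ.- + 1 ℤ.+ + 1 ≡ c
      cancel = ℤSolver.solve-∀
      arith : ∀ a b → a ℤ.- b ℤ.+ ℤ.- a ≡ ℤ.- b
      arith = ℤSolver.solve-∀

    rsum-nonzero : ∀ c rs → Desc rs → rsum c (nonzero rs) ≡ rsum c rs
    rsum-nonzero c []           d = refl
    rsum-nonzero c (zero  ∷ rs) d rewrite nonzero-zero rs d = sym (rsum-zeros c (zero ∷ rs) (z≤n ∷ d))
    rsum-nonzero c (suc r ∷ rs) d = cong (λ t → g (c ℤ.- + 1 ℤ.+ + suc r) ℤ.+ t) (rsum-nonzero (c ℤ.- + 1) rs (Linked.tail d))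

    wsum-gaps : ∀ s n w → wsum s (replicate n false ++ w) ≡ wsum s w
    wsum-gaps s zero    w = refl
    wsum-gaps s (suc n) w = wsum-gaps s n w

    rsum≡wsum : ∀ s h rs → Desc (h ∷ rs) → rsum (s ℤ.+ + length rs) rs ≡ wsum s (wordFrom h rs) ℤ.- δ s
    rsum≡wsum s zero    [] _ = trans (cong (λ z → ℤ.- δ z) (ℤ.+-identityʳ s)) (sym (ℤ.+-identityˡ _))
    rsum≡wsum s (suc h) [] _ = rsum≡wsum s h [] [-]
    rsum≡wsum s h (r ∷ rs) (_ ∷ d) rewrite wsum-gaps s (h ∸ r) (true ∷ wordFrom r rs) | length-wordFrom r rs d = begin
      g (c ℤ.- + 1 ℤ.+ + r) ℤ.+ rsum (c ℤ.- + 1) rs  ≡⟨ cong₂ (λ x y → g x ℤ.+ rsum y rs) (e₁ s (+ length rs) (+ r)) (e₂ s (+ length rs)) ⟩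
      g (s ℤ.+ + (r + length rs)) ℤ.+ rsum (s ℤ.+ + length rs) rs ≡⟨ cong (λ t → g (s ℤ.+ + (r + length rs)) ℤ.+ t) (rsum≡wsum s r rs d) ⟩
      g (s ℤ.+ + (r + length rs)) ℤ.+ (wsum s (wordFrom r rs) ℤ.- δ s) ≡⟨ ℤ.+-assoc (g (s ℤ.+ + (r + length rs))) (wsum s (wordFrom r rs)) (ℤ.- δ s) ⟨
      g (s ℤ.+ + (r + length rs)) ℤ.+ wsum s (wordFrom r rs) ℤ.- δ s ∎
      where
      open ≡-Reasoning
      c = s ℤ.+ + suc (length rs)
      e₁ : ∀ s n r → s ℤ.+ (+ 1 ℤ.+ n) ℤ.- + 1 ℤ.+ r ≡ s ℤ.+ (r ℤ.+ n)
      e₁ = ℤSolver.solve-∀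
      e₂ : ∀ s n → s ℤ.+ (+ 1 ℤ.+ n) ℤ.- + 1 ≡ s ℤ.+ n
      e₂ = ℤSolver.solve-∀

    -- A run from bottom B to top T contributes δ(B) - δ(T + 1), up to the shift `s`. The chain
    -- condition equates B with the current requirement and makes T + 1 the next one, so consecutive
    -- runs cancel; the final predicate pins the last requirement to `c`.
    chain-sum : ∀ s c e w → Chain (λ τ v → v ≡ 0 × τ ≈ c) e w → wsum s w ≡ δ (s ℤ.+ + e) ℤ.- δ (s ℤ.+ + c)
    -- The beads already read, from `T` down to `length w`, are not in `w`; the terms at `length w`
    -- and `suc T` make up for them.
    run-sum : ∀ s c e T w → Run (λ τ v → v ≡ 0 × τ ≈ c) e T w →
      wsum s w ≡ (δ (s ℤ.+ + e) ℤ.- δ (s ℤ.+ + length w)) ℤ.+ (δ (s ℤ.+ + suc T) ℤ.- δ (s ℤ.+ + c))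
    chain-sum s c e []          (_ , e≈c) = sym (trans (cong (ℤ._- δ (s ℤ.+ + c)) (δ-cong (shift s e≈c))) (ℤ.+-inverseʳ (δ (s ℤ.+ + c))))
    chain-sum s c e (false ∷ w) h = chain-sum s c e w h
    chain-sum s c e (true ∷ w)  h = trans (cong₂ (λ t u → (δ (s ℤ.+ + length w) ℤ.- t) ℤ.+ u) (δ-suc s (length w)) (run-sum s c e (length w) w h))
      (arith (δ (s ℤ.+ + length w)) (δ (s ℤ.+ + suc (length w))) (δ (s ℤ.+ + e)) (δ (s ℤ.+ + c)))
      where
      arith : ∀ n n′ e c → (n ℤ.- n′) ℤ.+ ((e ℤ.- n) ℤ.+ (n′ ℤ.- c)) ≡ e ℤ.- c
      arith = ℤSolver.solve-∀
    run-sum s c e T []          (() , _)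
    run-sum s c e T (true ∷ w)  h = trans (cong₂ (λ t u → (δ (s ℤ.+ + length w) ℤ.- t) ℤ.+ u) (δ-suc s (length w)) (run-sum s c e T w h))
      (arith (δ (s ℤ.+ + length w)) (δ (s ℤ.+ + suc (length w))) (δ (s ℤ.+ + e)) (δ (s ℤ.+ + suc T) ℤ.- δ (s ℤ.+ + c)))
      where
      arith : ∀ n n′ e c → (n ℤ.- n′) ℤ.+ ((e ℤ.- n) ℤ.+ c) ≡ (e ℤ.- n′) ℤ.+ c
      arith = ℤSolver.solve-∀
    run-sum s c e T (false ∷ w) ((a , _) , h) = trans (chain-sum s c (suc T) w h)
      (trans (sym (ℤ.+-identityˡ _)) (cong (λ t → t ℤ.+ (δ (s ℤ.+ + suc T) ℤ.- δ (s ℤ.+ + c)))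
        (trans (sym (ℤ.+-inverseʳ (δ (s ℤ.+ + suc (length w))))) (cong (ℤ._- δ (s ℤ.+ + suc (length w))) (sym (δ-cong (shift s a)))))))

  module EndValues (i : ℕ) where

    δ : ℤ → ℤ
    δ z = e p z i

    δ-cong : ∀ {z z′} → z ≋ z′ → δ z ≡ δ z′
    δ-cong z≋ = cong (λ r → if r ≡ᵇ i then + 1 else + 0) (res-cong z≋)

    open Potential δ δ-cong

    weight : ℤ × ℤ → ℤ
    weight rs = if res p (proj₁ rs) ≡ᵇ i then proj₂ rs else + 0

    count : List (ℤ × ℤ) → ℤ
    count = foldr (λ rs acc → weight rs ℤ.+ acc) (+ 0)

    count-++ : ∀ xs ys → count (xs ++ ys) ≡ count xs ℤ.+ count ys
    count-++ []       ys = sym (ℤ.+-identityˡ _)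
    count-++ (x ∷ xs) ys = trans (cong (λ t → weight x ℤ.+ t) (count-++ xs ys)) (sym (ℤ.+-assoc (weight x) (count xs) (count ys)))

    count-minus : ∀ z → (if res p z ≡ᵇ i then ℤ.-1ℤ else + 0) ≡ ℤ.- δ z
    count-minus z with res p z ≡ᵇ i
    ... | true  = refl
    ... | false = refl

    columnSeq : ℤ × ℤ → List (ℤ × ℤ)
    columnSeq xy = (proj₁ xy , ℤ.1ℤ) ∷ (proj₁ xy ℤ.+ + 1 , ℤ.-1ℤ)
                 ∷ (proj₂ xy , ℤ.1ℤ) ∷ (proj₂ xy ℤ.- + 1 , ℤ.-1ℤ) ∷ []

    count-column : ∀ x y → count (columnSeq (x , y)) ≡ g x ℤ.+ (δ y ℤ.- δ (y ℤ.- + 1))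
    count-column x y rewrite count-minus (x ℤ.+ + 1) | count-minus (y ℤ.- + 1) =
      arith (δ x) (δ (x ℤ.+ + 1)) (δ y) (δ (y ℤ.- + 1))
      where
      arith : ∀ a b c d → a ℤ.+ (ℤ.- b ℤ.+ (c ℤ.+ (ℤ.- d ℤ.+ + 0))) ≡ (a ℤ.- b) ℤ.+ (c ℤ.- d)
      arith = ℤSolver.solve-∀

    count-mullSeq : ∀ cs x y → count (mullSeq (cs ++ (x , y) ∷ [])) ≡ count (mullSeq cs) ℤ.+ (g x ℤ.+ (δ y ℤ.- δ (y ℤ.- + 1)))
    count-mullSeq cs x y = begin
      count (mullSeq (cs ++ (x , y) ∷ []))
        ≡⟨ cong (λ s → count ((+ 0 , ℤ.-1ℤ) ∷ s)) (concatMap-++ columnSeq cs ((x , y) ∷ [])) ⟩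
      count (mullSeq cs ++ columnSeq (x , y))
        ≡⟨ count-++ (mullSeq cs) (columnSeq (x , y)) ⟩
      count (mullSeq cs) ℤ.+ count (columnSeq (x , y))
        ≡⟨ cong (λ t → count (mullSeq cs) ℤ.+ t) (count-column x y) ⟩
      count (mullSeq cs) ℤ.+ (g x ℤ.+ (δ y ℤ.- δ (y ℤ.- + 1))) ∎
      where open ≡-Reasoning

    -- With s = -`k` the last column has x ≡ s + `lastLeader w` and y = s + 1, so it contributes
    -- g(x) - g(s), the opposite of the change in `wsum-idle`. The bound `n` makes the recursion
    -- over successive p-rims structural.
    endValue≡rsum : ∀ n λs → IsPartition λs → sum λs ≤ n → endValue p λs i ≡ rsum (+ 0) λs
    endValue≡rsum n       []           _ _ = trans (ℤ.+-identityʳ _) (count-minus (+ 0))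
    endValue≡rsum n       (zero ∷ ls)  (_ , () ∷ _)
    endValue≡rsum (suc n) (suc l ∷ ls) part (s≤s ≤n) = begin
      count (mullSeq (residueSymbol p μ))
        ≡⟨ cong (λ c → count (mullSeq c)) (residueSymbol-∷ (suc l) ls part) ⟩
      count (mullSeq (residueSymbol p (stripRim p μ) ++ lastColumn μ ∷ []))
        ≡⟨ count-mullSeq (residueSymbol p (stripRim p μ)) _ _ ⟩
      endValue p (stripRim p μ) i ℤ.+ (g (+ a ℤ.- + k) ℤ.+ (δ (+ 1 ℤ.- + k) ℤ.- δ (+ 1 ℤ.- + k ℤ.- + 1)))
        ≡⟨ cong₂ ℤ._+_ (trans (endValue≡rsum n (stripRim p μ) (strip-partition μ part) (≤-trans (strip-sum l ls part) ≤n)) strip≡)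
             (cong₂ ℤ._+_ x≡ (cong₂ ℤ._-_ (cong δ (ℤ.+-comm (+ 1) s)) (cong δ (cancel (+ k))))) ⟩
      wsum s w ℤ.+ (g s ℤ.- gL) ℤ.- δ s ℤ.+ (gL ℤ.+ (δ (s ℤ.+ + 1) ℤ.- δ s))
        ≡⟨ arith (wsum s w) (δ s) (δ (s ℤ.+ + 1)) gL ⟩
      wsum s w ℤ.- δ s
        ≡⟨ cong (λ v → wsum s v ℤ.- δ s) word-μ ⟨
      wsum s (wordFrom (suc l) μ) ℤ.- δ s
        ≡⟨ rsum≡wsum s (suc l) μ (≤-refl ∷ proj₁ part) ⟨
      rsum (s ℤ.+ + k) μ
        ≡⟨ cong (λ c → rsum c μ) (ℤ.+-inverseˡ (+ k)) ⟩
      rsum (+ 0) μ ∎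
      where
      open ≡-Reasoning
      open StripRim l ls part
      s gL : ℤ
      s = ℤ.- + k
      gL = g (s ℤ.+ + lastLeader w)
      cancel : ∀ k → + 1 ℤ.- k ℤ.- + 1 ≡ ℤ.- k
      cancel = ℤSolver.solve-∀
      arith : ∀ W d e L → W ℤ.+ ((d ℤ.- e) ℤ.- L) ℤ.- d ℤ.+ (L ℤ.+ (e ℤ.- d)) ≡ W ℤ.- d
      arith = ℤSolver.solve-∀
      x≡ : g (+ a ℤ.- + k) ≡ gL
      x≡ = trans (cong g (ℤ.+-comm (+ a) s)) (g-shift s (≈-sym leader≈))
      strip≡ : rsum (+ 0) (stripRim p μ) ≡ wsum s w ℤ.+ (g s ℤ.- gL) ℤ.- δ s
      strip≡ = begin
        rsum (+ 0) (stripRim p μ)    ≡⟨ rsum-nonzero (+ 0) rows (Linked.tail desc-rows) ⟩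
        rsum (+ 0) rows              ≡⟨ cong (λ c → rsum c rows) (trans (cong (λ n → s ℤ.+ + n) length-rows) (ℤ.+-inverseˡ (+ k))) ⟨
        rsum (s ℤ.+ + length rows) rows ≡⟨ rsum≡wsum s (suc l) rows desc-rows ⟩
        wsum s (wordFrom (suc l) rows) ℤ.- δ s ≡⟨ cong (λ v → wsum s v ℤ.- δ s) word-rows ⟨
        wsum s (idle w) ℤ.- δ s      ≡⟨ cong (ℤ._- δ s) (wsum-idle s w (ends-word true l ls (All.tail (proj₂ part)))) ⟩
        wsum s w ℤ.+ (g s ℤ.- gL) ℤ.- δ s ∎

    endValue-JS : ∀ l ls α → IsPartition (suc l ∷ ls) → IsJS p (suc l ∷ ls) (+ α) →
      endValue p (suc l ∷ ls) i ≡ δ (+ α) ℤ.- δ (+ α ℤ.+ + suc (length ls)) ℤ.- δ (ℤ.- + suc (length ls))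
    endValue-JS l ls α part js = begin
      endValue p μ i                       ≡⟨ endValue≡rsum _ μ part ≤-refl ⟩
      rsum (+ 0) μ                         ≡⟨ cong (λ c → rsum c μ) (ℤ.+-inverseˡ (+ k)) ⟨
      rsum (s ℤ.+ + k) μ                   ≡⟨ rsum≡wsum s (suc l) μ (≤-refl ∷ proj₁ part) ⟩
      wsum s (wordFrom (suc l) μ) ℤ.- δ s  ≡⟨ cong (λ v → wsum s v ℤ.- δ s) word-μ ⟩
      wsum s w ℤ.- δ s                     ≡⟨ cong (ℤ._- δ s) (chain-sum s (α + k + k) (α + k) w
                                                (from (js⇔chain (λ τ v → v ≡ 0 × τ ≈ α + k + k)
                                                  (λ { τ≈ (v , τ≈c) → v , ≈-trans (≈-sym τ≈) τ≈c }) α) (js , n∸n≡0 k , ≈-refl))) ⟩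
      δ (s ℤ.+ + (α + k)) ℤ.- δ (s ℤ.+ + (α + k + k)) ℤ.- δ s
        ≡⟨ cong₂ (λ x y → δ x ℤ.- δ y ℤ.- δ s) (e₁ (+ α) (+ k)) (e₂ (+ α) (+ k)) ⟩
      δ (+ α) ℤ.- δ (+ α ℤ.+ + k) ℤ.- δ s ∎
      where
      open ≡-Reasoning
      open StripRim l ls part
      s = ℤ.- + k
      e₁ : ∀ α k → ℤ.- k ℤ.+ (α ℤ.+ k) ≡ α
      e₁ = ℤSolver.solve-∀
      e₂ : ∀ α k → ℤ.- k ℤ.+ (α ℤ.+ k ℤ.+ k) ≡ α ℤ.+ k
      e₂ = ℤSolver.solve-∀

  -- The three statements in terms of residue symbols.

  BaseColumn : ℕ → ℤ → ℤ → Set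
  BaseColumn α x₁ y₁ =
    (Cong p x₁ (+ 0) × Cong p y₁ (+ α) × ¬ Cong p (+ α) (+ 1))
    ⊎ (Cong p x₁ (+ α) × Cong p y₁ (+ 0))
    ⊎ (Cong p x₁ (+ α) × Cong p y₁ (+ α ℤ.+ + 1) × ¬ Cong p (+ α) (+ 0))

  ExtensionColumn : ℕ → ℤ → ℤ → ℤ → Set
  ExtensionColumn α yₖ x y =
    (Cong p x (+ α ℤ.+ + 1 ℤ.- yₖ) × Cong p y (yₖ ℤ.- + 1) × ¬ Cong p (+ 2 ℤ.* yₖ) (+ α ℤ.+ + 3))
    ⊎ (Cong p x (yₖ ℤ.- + 1) × Cong p y (+ α ℤ.+ + 1 ℤ.- yₖ) × ¬ Cong p (+ 2 ℤ.* yₖ) (+ α ℤ.+ + 1))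
    ⊎ (Cong p x (yₖ ℤ.- + 1) × Cong p y yₖ)
    ⊎ (Cong p x (+ α ℤ.+ + 1 ℤ.- yₖ) × Cong p y (+ α ℤ.+ + 2 ℤ.- yₖ))

  base⇔ : ∀ α x y → Base α x y ⇔ BaseColumn α x y
  base⇔ α x y = mk⇔
    (λ { (inj₁ (mk≋ cx , mk≋ cy , ¬c))        → inj₁ (cx , cy , ¬c ∘ mk≋)
       ; (inj₂ (inj₁ (mk≋ cx , mk≋ cy)))      → inj₂ (inj₁ (cx , cy))
       ; (inj₂ (inj₂ (mk≋ cx , mk≋ cy , ¬c))) → inj₂ (inj₂ (cx , cy , ¬c ∘ mk≋)) })
    (λ { (inj₁ (cx , cy , ¬c))        → inj₁ (mk≋ cx , mk≋ cy , ¬c ∘ toCong)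
       ; (inj₂ (inj₁ (cx , cy)))      → inj₂ (inj₁ (mk≋ cx , mk≋ cy))
       ; (inj₂ (inj₂ (cx , cy , ¬c))) → inj₂ (inj₂ (mk≋ cx , mk≋ cy , ¬c ∘ toCong)) })

  extension⇔ : ∀ α yₖ x y → Extension α yₖ x y ⇔ ExtensionColumn α yₖ x y
  extension⇔ α yₖ x y = mk⇔
    (λ { (inj₁ (mk≋ cx , mk≋ cy , ¬c))               → inj₁ (cx , cy , ¬c ∘ mk≋)
       ; (inj₂ (inj₁ (mk≋ cx , mk≋ cy , ¬c)))        → inj₂ (inj₁ (cx , cy , ¬c ∘ mk≋))
       ; (inj₂ (inj₂ (inj₁ (mk≋ cx , mk≋ cy))))      → inj₂ (inj₂ (inj₁ (cx , cy)))
       ; (inj₂ (inj₂ (inj₂ (mk≋ cx , mk≋ cy))))      → inj₂ (inj₂ (inj₂ (cx , cy))) })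
    (λ { (inj₁ (cx , cy , ¬c))               → inj₁ (mk≋ cx , mk≋ cy , ¬c ∘ toCong)
       ; (inj₂ (inj₁ (cx , cy , ¬c)))        → inj₂ (inj₁ (mk≋ cx , mk≋ cy , ¬c ∘ toCong))
       ; (inj₂ (inj₂ (inj₁ (cx , cy))))      → inj₂ (inj₂ (inj₁ (mk≋ cx , mk≋ cy)))
       ; (inj₂ (inj₂ (inj₂ (cx , cy))))      → inj₂ (inj₂ (inj₂ (mk≋ cx , mk≋ cy))) })

  residueSymbol-split : ∀ l ls cs c → IsPartition (l ∷ ls) → residueSymbol p (l ∷ ls) ≡ cs ++ c ∷ [] →
    residueSymbol p (stripRim p (l ∷ ls)) ≡ cs × lastColumn (l ∷ ls) ≡ c
  residueSymbol-split l ls cs c part eq = ∷ʳ-injective _ _ (trans (sym (residueSymbol-∷ l ls part)) eq)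

  residueSymbol-empty : ∀ λs → IsPartition λs → residueSymbol p λs ≡ [] → λs ≡ []
  residueSymbol-empty []       _    _  = refl
  residueSymbol-empty (l ∷ ls) part eq with ++-conicalʳ (residueSymbol p (stripRim p (l ∷ ls))) _ (trans (sym (residueSymbol-∷ l ls part)) eq)
  ... | ()

  part₁ : ∀ α λs x₁ y₁ → IsPartition λs → PRegular p λs → residueSymbol p λs ≡ (x₁ , y₁) ∷ [] →
    IsJS p λs (+ α) ⇔ BaseColumn α x₁ y₁
  part₁ α []           x₁ y₁ _            _   ()
  part₁ α (zero ∷ ls)  x₁ y₁ (_ , () ∷ _)
  part₁ α (suc l ∷ ls) x₁ y₁ part reg eq with residueSymbol-split (suc l) ls [] (x₁ , y₁) part eq
  ... | none , refl = base⇔ α _ _ ⇔-∘ mk⇔ (λ js → base⁺ α a k z<s (js-base α nil js)) (λ b → js-base⁻ α reg nil (base⁻ α a k b))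
    where
    open StripRim l ls part
    nil : stripRim p μ ≡ []
    nil = residueSymbol-empty (stripRim p μ) (strip-partition μ part) none

  part₂ : ∀ α μ cs xₖ yₖ x y → IsPartition μ → PRegular p μ → residueSymbol p μ ≡ cs ++ (xₖ , yₖ) ∷ (x , y) ∷ [] →
    IsJS p μ (+ α) ⇔ (IsJS p (stripRim p μ) (+ α) × ExtensionColumn α yₖ x y)
  part₂ α []           cs xₖ yₖ x y _ _ eq with ++-conicalʳ cs ((xₖ , yₖ) ∷ (x , y) ∷ []) (sym eq)
  ... | ()
  part₂ α (zero ∷ ls)  cs xₖ yₖ x y (_ , () ∷ _)
  part₂ α (suc l ∷ ls) cs xₖ yₖ x y part reg eq
    with residueSymbol-split (suc l) ls (cs ++ (xₖ , yₖ) ∷ []) (x , y) part (trans eq (sym (++-assoc cs _ _)))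
  ... | eq′ , refl = mk⇔
      (λ js → let js′ , ec = to (js-step α reg ne) js in
        js′ , to (extension⇔ α yₖ _ _) (subst₂ (λ yₖ n → Extension α yₖ (+ a ℤ.- + n) (+ 1 ℤ.- + n)) last≡ (sym k≡v+k′)
          (extension⁺ α a v k′ (subst (λ n → EndCond a (α + n + k′) v) k≡v+k′ ec))))
      (λ { (js′ , ext) → from (js-step α reg ne) (js′ , subst (λ n → EndCond a (α + n + k′) v) (sym k≡v+k′)
          (extension⁻ α a v k′ (subst₂ (λ yₖ n → Extension α yₖ (+ a ℤ.- + n) (+ 1 ℤ.- + n)) (sym last≡) k≡v+k′
            (from (extension⇔ α yₖ _ _) ext)))) })
    where
    open StripRim l ls part
    last-row : ∀ λs → IsPartition λs → residueSymbol p λs ≡ cs ++ (xₖ , yₖ) ∷ [] → λs ≢ [] × + 1 ℤ.- + length λs ≡ yₖ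
    last-row []       _     eq with ++-conicalʳ cs ((xₖ , yₖ) ∷ []) (sym eq)
    ... | ()
    last-row (m ∷ ms) part′ eq = (λ ()) , cong proj₂ (proj₂ (residueSymbol-split m ms cs (xₖ , yₖ) part′ eq))
    ne : stripRim p μ ≢ []
    ne = proj₁ (last-row (stripRim p μ) (strip-partition μ part) eq′)
    last≡ : + 1 ℤ.- + k′ ≡ yₖ
    last≡ = proj₂ (last-row (stripRim p μ) (strip-partition μ part) eq′)

  EndValueAlternatives : ℕ → List ℕ → ℤ → Set
  EndValueAlternatives α λs yₖ =
    (((i : ℕ) → i < p → endValue p λs i ≡ ℤ.- e p (+ 0) i)
      × (Cong p yₖ (+ 1) ⊎ Cong p yₖ (+ α ℤ.+ + 1)))
    ⊎ (Σ ℕ λ β → β < p × β ≢ α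
      × ((i : ℕ) → i < p → endValue p λs i ≡ e p (+ α) i ℤ.- e p (+ β) i ℤ.- e p (+ α ℤ.- + β) i)
      × (Cong p yₖ (+ 1 ℤ.+ + β) ⊎ Cong p yₖ (+ α ℤ.+ + 1 ℤ.- + β)))
    ⊎ ((Σ ℕ λ h → α ≡ h + h × α ≢ 0
        × ((i : ℕ) → i < p → endValue p λs i ≡ e p (+ α) i ℤ.- + 2 ℤ.* e p (+ h) i)
        × Cong p yₖ (+ h ℤ.+ + 1))
      ⊎ (Σ ℕ λ h → α + p ≡ h + h
        × ((i : ℕ) → i < p → endValue p λs i ≡ e p (+ α) i ℤ.- + 2 ℤ.* e p (+ h) i)
        × Cong p yₖ (+ h ℤ.+ + 1)))

  -- Case (c) is the instance β = h of case (b).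
  part₃ : ∀ α λs cs xₖ yₖ → IsPartition λs → IsJS p λs (+ α) → residueSymbol p λs ≡ cs ++ (xₖ , yₖ) ∷ [] →
    EndValueAlternatives α λs yₖ
  part₃ α []           cs xₖ yₖ _ (_ , _ , ()) eq
  part₃ α (zero ∷ ls)  cs xₖ yₖ (_ , () ∷ _)
  part₃ α (suc l ∷ ls) cs xₖ yₖ part js eq with residueSymbol-split (suc l) ls cs (xₖ , yₖ) part eq
  -- Let k be the number of rows and `β` the representative of -k. If `β` is α, then α + k ≡ 0, so
  -- δ(α) cancels δ(-k) and -δ(0) is left, which is (a); otherwise `β` serves in (b).
  ... | _ , refl = alternatives (res p (ℤ.- K) ≟ α)
    where
    K : ℤ
    K = + suc (length ls)
    β : ℕ
    β = res p (ℤ.- K)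
    β≋ : + β ≋ ℤ.- K
    β≋ = res≋ (ℤ.- K)
    alternatives : _ → EndValueAlternatives α (suc l ∷ ls) (+ 1 ℤ.- K)
    alternatives (yes β≡α) = inj₁ ((λ i _ → trans (EndValues.endValue-JS i l ls α part js) (value i)) ,
                                   inj₂ (toCong {+ 1 ℤ.- K} {+ α ℤ.+ + 1} (scale (ℤ.- + 1) (e₁ (+ α) K) α≋)))
      where
      α≋ : + α ≋ ℤ.- K
      α≋ = subst (λ n → + n ≋ ℤ.- K) β≡α β≋
      e₁ : ∀ α k → (+ 1 ℤ.- k) ℤ.- (α ℤ.+ + 1) ≡ (ℤ.- + 1) ℤ.* (α ℤ.- ℤ.- k)
      e₁ = ℤSolver.solve-∀
      e₂ : ∀ α k → (α ℤ.+ k) ℤ.- + 0 ≡ + 1 ℤ.* (α ℤ.- ℤ.- k)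
      e₂ = ℤSolver.solve-∀
      e₃ : ∀ a b → a ℤ.- b ℤ.- a ≡ ℤ.- b
      e₃ = ℤSolver.solve-∀
      value : ∀ i → e p (+ α) i ℤ.- e p (+ α ℤ.+ K) i ℤ.- e p (ℤ.- K) i ≡ ℤ.- e p (+ 0) i
      value i = trans (cong₂ (λ b a → e p (+ α) i ℤ.- b ℤ.- a) (δ-cong {+ α ℤ.+ K} {+ 0} (scale (+ 1) (e₂ (+ α) K) α≋)) (δ-cong {ℤ.- K} {+ α} (≋-sym α≋)))
        (e₃ (e p (+ α) i) (e p (+ 0) i))
        where open EndValues i using (δ-cong)
    alternatives (no β≢α) = inj₂ (inj₁ (β , res-< (ℤ.- K) , β≢α ,
        (λ i _ → trans (EndValues.endValue-JS i l ls α part js) (value i)) ,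
        inj₁ (toCong {+ 1 ℤ.- K} {+ 1 ℤ.+ + β} (scale (ℤ.- + 1) (e₁ (+ β) K) β≋))))
      where
      e₁ : ∀ β k → (+ 1 ℤ.- k) ℤ.- (+ 1 ℤ.+ β) ≡ (ℤ.- + 1) ℤ.* (β ℤ.- ℤ.- k)
      e₁ = ℤSolver.solve-∀
      e₂ : ∀ α β k → (α ℤ.+ k) ℤ.- (α ℤ.- β) ≡ + 1 ℤ.* (β ℤ.- ℤ.- k)
      e₂ = ℤSolver.solve-∀
      e₃ : ∀ a b c → a ℤ.- b ℤ.- c ≡ a ℤ.- c ℤ.- b
      e₃ = ℤSolver.solve-∀
      value : ∀ i → e p (+ α) i ℤ.- e p (+ α ℤ.+ K) i ℤ.- e p (ℤ.- K) i ≡ e p (+ α) i ℤ.- e p (+ β) i ℤ.- e p (+ α ℤ.- + β) i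
      value i = trans (cong₂ (λ b a → e p (+ α) i ℤ.- b ℤ.- a) (δ-cong {+ α ℤ.+ K} {+ α ℤ.- + β} (scale (+ 1) (e₂ (+ α) (+ β) K) β≋)) (δ-cong {ℤ.- K} {+ β} (≋-sym β≋)))
        (e₃ (e p (+ α) i) (e p (+ α ℤ.- + β) i) (e p (+ β) i))
        where open EndValues i using (δ-cong)

theorem3p1 : (p : ℕ) → 2 ≤ p → (α : ℕ) → α < p →
    ((λs : List ℕ) (x₁ y₁ : ℤ) → IsPartition λs → PRegular p λs →
    residueSymbol p λs ≡ (x₁ , y₁) ∷ [] →
    (IsJS p λs (+ α) ⇔
    ((Cong p x₁ (+ 0) × Cong p y₁ (+ α) × ¬ Cong p (+ α) (+ 1))
    ⊎ (Cong p x₁ (+ α) × Cong p y₁ (+ 0))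
    ⊎ (Cong p x₁ (+ α) × Cong p y₁ (+ α ℤ.+ + 1) × ¬ Cong p (+ α) (+ 0)))))
    ×
    ((μ : List ℕ) (cs : List (ℤ × ℤ)) (xₖ yₖ x y : ℤ) → IsPartition μ → PRegular p μ →
    residueSymbol p μ ≡ cs ++ (xₖ , yₖ) ∷ (x , y) ∷ [] →
    (IsJS p μ (+ α) ⇔
    (IsJS p (stripRim p μ) (+ α) ×
    ((Cong p x (+ α ℤ.+ + 1 ℤ.- yₖ) × Cong p y (yₖ ℤ.- + 1)
    × ¬ Cong p (+ 2 ℤ.* yₖ) (+ α ℤ.+ + 3))
    ⊎ (Cong p x (yₖ ℤ.- + 1) × Cong p y (+ α ℤ.+ + 1 ℤ.- yₖ)
    × ¬ Cong p (+ 2 ℤ.* yₖ) (+ α ℤ.+ + 1))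
    ⊎ (Cong p x (yₖ ℤ.- + 1) × Cong p y yₖ)
    ⊎ (Cong p x (+ α ℤ.+ + 1 ℤ.- yₖ) × Cong p y (+ α ℤ.+ + 2 ℤ.- yₖ))))))
    ×
    ((λs : List ℕ) (cs : List (ℤ × ℤ)) (xₖ yₖ : ℤ) → IsPartition λs → IsJS p λs (+ α) →
    residueSymbol p λs ≡ cs ++ (xₖ , yₖ) ∷ [] →
    (((i : ℕ) → i < p → endValue p λs i ≡ ℤ.- e p (+ 0) i)
    × (Cong p yₖ (+ 1) ⊎ Cong p yₖ (+ α ℤ.+ + 1)))
    ⊎
    (Σ ℕ λ β → β < p × β ≢ α
    × ((i : ℕ) → i < p →
    endValue p λs i ≡ e p (+ α) i ℤ.- e p (+ β) i ℤ.- e p (+ α ℤ.- + β) i)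
    × (Cong p yₖ (+ 1 ℤ.+ + β) ⊎ Cong p yₖ (+ α ℤ.+ + 1 ℤ.- + β)))
    ⊎
    ((Σ ℕ λ h → α ≡ h + h × α ≢ 0
    × ((i : ℕ) → i < p → endValue p λs i ≡ e p (+ α) i ℤ.- + 2 ℤ.* e p (+ h) i)
    × Cong p yₖ (+ h ℤ.+ + 1))
    ⊎ (Σ ℕ λ h → α + p ≡ h + h
    × ((i : ℕ) → i < p → endValue p λs i ≡ e p (+ α) i ℤ.- + 2 ℤ.* e p (+ h) i)
    × Cong p yₖ (+ h ℤ.+ + 1))))
theorem3p1 (suc (suc q)) (s≤s (s≤s z≤n)) α _ = part₁ α , part₂ α , part₃ α
  where open Modulo q
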